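{- Let $(G,s,t)$ be an $st$-connected net. Then $G$ is vulnerable if and only if there exists an $st$-embedding of the Wheatstone graph $\mathcal W$ into $(G,s,t)$.
   Context: Graphs are finite. A multi-digraph $G=(V,E)$ has a set $V$ of nodes and a set $E$ of edges, each edge relating an ordered pair of nodes; parallel edges are allowed. A net $(G,s,t)$ is a multi-digraph with a chosen source $s$ and target $t$. A path is a sequence $u_1e_1u_2\dots e_{n-1}u_n$ ($n\ge 1$) with $e_i$ relating $(u_i,u_{i+1})$; it is simple if no node repeats. An $st$-path is a path from $s$ to $t$; $SP(G)$ is the set of simple $st$-paths. The net is $st$-connected if every node lies on an $st$-path (not necessarily simple). Flows and vulnerability. Let $\mathbb R^+$ be the non-negative reals. A flow is a function $\varphi:SP(G)\to\mathbb R^+$; its value is $\sum_p\varphi(p)$, and $\varphi(e)=\sum_{p\in SP(G):\,e\in p}\varphi(p)$ for an edge $e$ (an $st$-path that is not simple carries no flow). A latency function $l$ assigns to each edge $e$ a continuous non-decreasing function $l_e:\mathbb R^+\to\mathbb R^+$; the latency of an $st$-path $p$ is $l_p(\varphi)=\sum_{e\in p}l_e(\varphi(e))$. An instance is $(G,r,l)$ with $r\in\mathbb R^+$. A flow of value $r$ is a Wardrop flow for $(G,r,l)$ if for all $st$-paths $p,q$ with $\varphi(p)>0$ one has $l_p(\varphi)\le l_q(\varphi)$. For $r>0$ (and $G$ having at least one $st$-path) a Wardrop flow exists, and $L(G,r,l)$ denotes the common latency of all $st$-paths with positive flow in a Wardrop flow (it does not depend on the Wardrop flow chosen); $L(G,0,l)=0$.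 The net $G$ is vulnerable if there exist $r$, $l$ and a subgraph $H$ of $G$ (with the same $s,t$, and containing at least one $st$-path) such that $L(G,r,l)>L(H,r,l|_H)$, where $l|_H$ is the restriction of $l$ to the edges of $H$. Embedding. $\mathcal W$ is the digraph with nodes $a,b,c,d$ and edges $a\to b$, $a\to c$, $b\to c$, $b\to d$, $c\to d$. An $st$-embedding of $\mathcal W$ into $(G,s,t)$ consists of an injective map $\phi$ from the nodes of $\mathcal W$ to the nodes of $G$ and an injective map $\psi$ assigning to each edge $x\to y$ of $\mathcal W$ a simple path of $G$ from $\phi(x)$ to $\phi(y)$, such that the five paths in the image of $\psi$ are pairwise node-disjoint except for the endpoints they share as images of common endpoints in $\mathcal W$; and such that there are (possibly empty) simple paths from $s$ to $\phi(a)$ and from $\phi(d)$ to $t$ that are node-disjoint from each other and that meet the paths in the image of $\psi$ only in $\phi(a)$ and only in $\phi(d)$, respectively. -}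

module Defs where

import Algebra.Properties.Group as GroupProperties
import Axiom.UniquenessOfIdentityProofs as UIP
open import Data.Fin.Base using (Fin; zero; suc)
import Data.Fin.Properties as Fin
open import Data.List.Base as List using (List; []; _∷_; _++_; length; lookup)
open import Data.List.Membership.Propositional using (_∈_; _∉_)
open import Data.List.Membership.Propositional.Properties
  using (∈-++⁺ˡ; ∈-++⁺ʳ; ∈-++⁻; ∈-map⁺; ∈-map⁻; ∈-concatMap⁺; ∈-lookup; ∈-allFin)
import Data.List.Membership.DecPropositional as DecMembership
open import Data.List.Relation.Binary.Disjoint.Propositional using (Disjoint)
open import Data.List.Relation.Unary.All as All using (All; []; _∷_)
import Data.List.Relation.Unary.All.Properties as All
open import Data.List.Relation.Unary.AllPairs as AllPairs using ([]; _∷_)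
import Data.List.Relation.Unary.AllPairs.Properties as AllPairs
open import Data.List.Relation.Unary.Any as Any using (here; there)
open import Data.List.Relation.Unary.Unique.Propositional using (Unique)
import Data.List.Relation.Unary.Unique.Propositional.Properties as Unique
import Data.List.Relation.Unary.Unique.DecPropositional as DecUnique
open import Data.Nat.Base as ℕ using (ℕ; zero; suc)
import Data.Nat.Properties as ℕ
open import Data.Product.Base using (Σ; ∃; _×_; _,_; proj₂)
open import Data.Rational.Base as ℚ using (ℚ; 0ℚ; ½)
import Data.Rational.Properties as ℚ
open import Data.Sum.Base using (_⊎_; inj₁; inj₂)
import Data.Vec.Base as Vec
open import Function.Base using (_∘_)
open import Function.Definitions using (Injective)
open import Relation.Binary.PropositionalEquality
open import Relation.Nullary using (¬_; Dec; yes; no; contradiction; recompute)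

------------------------------------------------------------------------
-- Real numbers: Cauchy sequences of rationals.  Equality of reals is _≃_.

Eventually : (ℕ → Set) → Set
Eventually P = ∃ λ N → ∀ n → N ℕ.≤ n → P n

IsCauchy : (ℕ → ℚ) → Set
IsCauchy x = ∀ ε → 0ℚ ℚ.< ε →
  ∃ λ N → ∀ m n → N ℕ.≤ m → N ℕ.≤ n → ℚ.∣ x m ℚ.- x n ∣ ℚ.< ε

record ℝ : Set where
  constructor mkℝ
  field
    seq    : ℕ → ℚ
    cauchy : IsCauchy seq

open ℝ public

infix 4 _≃_ _≤_ _<_

_≃_ : ℝ → ℝ → Set
x ≃ y = ∀ ε → 0ℚ ℚ.< ε → Eventually λ n → ℚ.∣ seq x n ℚ.- seq y n ∣ ℚ.< ε

_≤_ : ℝ → ℝ → Set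
x ≤ y = ∀ ε → 0ℚ ℚ.< ε → Eventually λ n → seq x n ℚ.< seq y n ℚ.+ ε

_<_ : ℝ → ℝ → Set
x < y = ∃ λ ε → 0ℚ ℚ.< ε × Eventually λ n → seq x n ℚ.+ ε ℚ.< seq y n

private
  module ℚ+ = GroupProperties ℚ.+-0-group

  half>0 : ∀ {ε} → 0ℚ ℚ.< ε → 0ℚ ℚ.< ½ ℚ.* ε
  half>0 {ε} ε>0 =
    subst (ℚ._< ½ ℚ.* ε) (ℚ.*-zeroʳ ½) (ℚ.*-monoʳ-<-pos ½ ε>0)

  half+half : ∀ ε → ½ ℚ.* ε ℚ.+ ½ ℚ.* ε ≡ ε
  half+half ε = trans (sym (ℚ.*-distribʳ-+ ε ½ ½)) (ℚ.*-identityˡ ε)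

  interchange : ∀ a b c d → (a ℚ.+ b) ℚ.+ (c ℚ.+ d) ≡ (a ℚ.+ c) ℚ.+ (b ℚ.+ d)
  interchange a b c d = begin
    (a ℚ.+ b) ℚ.+ (c ℚ.+ d)  ≡⟨ ℚ.+-assoc a b (c ℚ.+ d) ⟩
    a ℚ.+ (b ℚ.+ (c ℚ.+ d))  ≡⟨ cong (a ℚ.+_) (ℚ.+-assoc b c d) ⟨
    a ℚ.+ ((b ℚ.+ c) ℚ.+ d)  ≡⟨ cong (λ t → a ℚ.+ (t ℚ.+ d)) (ℚ.+-comm b c) ⟩
    a ℚ.+ ((c ℚ.+ b) ℚ.+ d)  ≡⟨ cong (a ℚ.+_) (ℚ.+-assoc c b d) ⟩
    a ℚ.+ (c ℚ.+ (b ℚ.+ d))  ≡⟨ ℚ.+-assoc a c (b ℚ.+ d) ⟨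
    (a ℚ.+ c) ℚ.+ (b ℚ.+ d)  ∎
    where open ≡-Reasoning

  ∣∣-sub-+ : ∀ a b c d →
    ℚ.∣ (a ℚ.+ b) ℚ.- (c ℚ.+ d) ∣ ℚ.≤ ℚ.∣ a ℚ.- c ∣ ℚ.+ ℚ.∣ b ℚ.- d ∣
  ∣∣-sub-+ a b c d = subst
    (λ t → ℚ.∣ t ∣ ℚ.≤ ℚ.∣ a ℚ.- c ∣ ℚ.+ ℚ.∣ b ℚ.- d ∣)
    (trans (interchange a (ℚ.- c) b (ℚ.- d))
           (cong ((a ℚ.+ b) ℚ.+_) (sym (ℚ.neg-distrib-+ c d))))
    (ℚ.∣p+q∣≤∣p∣+∣q∣ (a ℚ.- c) (b ℚ.- d))

  ∣∣-sub-neg : ∀ a b → ℚ.∣ ℚ.- a ℚ.- ℚ.- b ∣ ≡ ℚ.∣ a ℚ.- b ∣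
  ∣∣-sub-neg a b =
    trans (cong ℚ.∣_∣ (sym (ℚ.neg-distrib-+ a (ℚ.- b)))) (ℚ.∣-p∣≡∣p∣ (a ℚ.- b))

  ∣∣-triangle : ∀ a b → ℚ.∣ a ∣ ℚ.- ℚ.∣ b ∣ ℚ.≤ ℚ.∣ a ℚ.- b ∣
  ∣∣-triangle a b = begin
    ℚ.∣ a ∣ ℚ.- ℚ.∣ b ∣
      ≡⟨ cong (λ t → ℚ.∣ t ∣ ℚ.- ℚ.∣ b ∣) (cancel a b) ⟨
    ℚ.∣ (a ℚ.- b) ℚ.+ b ∣ ℚ.- ℚ.∣ b ∣
      ≤⟨ ℚ.+-monoˡ-≤ (ℚ.- ℚ.∣ b ∣) (ℚ.∣p+q∣≤∣p∣+∣q∣ (a ℚ.- b) b) ⟩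
    (ℚ.∣ a ℚ.- b ∣ ℚ.+ ℚ.∣ b ∣) ℚ.- ℚ.∣ b ∣
      ≡⟨ ℚ.+-assoc ℚ.∣ a ℚ.- b ∣ ℚ.∣ b ∣ (ℚ.- ℚ.∣ b ∣) ⟩
    ℚ.∣ a ℚ.- b ∣ ℚ.+ (ℚ.∣ b ∣ ℚ.- ℚ.∣ b ∣)
      ≡⟨ cong (ℚ.∣ a ℚ.- b ∣ ℚ.+_) (ℚ.+-inverseʳ ℚ.∣ b ∣) ⟩
    ℚ.∣ a ℚ.- b ∣ ℚ.+ 0ℚ
      ≡⟨ ℚ.+-identityʳ ℚ.∣ a ℚ.- b ∣ ⟩
    ℚ.∣ a ℚ.- b ∣ ∎
    where
    open ℚ.≤-Reasoning
    cancel : ∀ a b → (a ℚ.- b) ℚ.+ b ≡ a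
    cancel a b = trans (ℚ.+-assoc a (ℚ.- b) b)
      (trans (cong (a ℚ.+_) (ℚ.+-inverseˡ b)) (ℚ.+-identityʳ a))

  ∣-∣-comm : ∀ a b → ℚ.∣ a ℚ.- b ∣ ≡ ℚ.∣ b ℚ.- a ∣
  ∣-∣-comm a b = trans (sym (ℚ.∣-p∣≡∣p∣ (a ℚ.- b))) (cong ℚ.∣_∣
    (ℚ+.⁻¹-anti-homo-// a b))

  ∣∣-sub-∣∣ : ∀ a b → ℚ.∣ ℚ.∣ a ∣ ℚ.- ℚ.∣ b ∣ ∣ ℚ.≤ ℚ.∣ a ℚ.- b ∣
  ∣∣-sub-∣∣ a b with ℚ.∣p∣≡p∨∣p∣≡-p (ℚ.∣ a ∣ ℚ.- ℚ.∣ b ∣)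
  ... | inj₁ eq = subst (ℚ._≤ ℚ.∣ a ℚ.- b ∣) (sym eq) (∣∣-triangle a b)
  ... | inj₂ eq = subst₂ ℚ._≤_ (sym (trans eq (ℚ+.⁻¹-anti-homo-// ℚ.∣ a ∣ ℚ.∣ b ∣)))
                                   (∣-∣-comm b a) (∣∣-triangle b a)

fromℚ : ℚ → ℝ
fromℚ q = mkℝ (λ _ → q) λ ε ε>0 → 0 , λ _ _ _ _ →
  subst (ℚ._< ε) (sym (cong ℚ.∣_∣ (ℚ.+-inverseʳ q))) ε>0

0ℝ : ℝ
0ℝ = fromℚ 0ℚ

infix  8 -_
infixl 6 _+_ _-_

_+_ : ℝ → ℝ → ℝ
x + y = mkℝ (λ n → seq x n ℚ.+ seq y n) λ ε ε>0 →
  let N₁ , h₁ = cauchy x (½ ℚ.* ε) (half>0 ε>0)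
      N₂ , h₂ = cauchy y (½ ℚ.* ε) (half>0 ε>0)
  in N₁ ℕ.⊔ N₂ , λ m n N≤m N≤n →
    ℚ.≤-<-trans (∣∣-sub-+ (seq x m) (seq y m) (seq x n) (seq y n))
      (subst (_ ℚ.<_) (half+half ε) (ℚ.+-mono-<
        (h₁ m n (ℕ.m⊔n≤o⇒m≤o N₁ N₂ N≤m) (ℕ.m⊔n≤o⇒m≤o N₁ N₂ N≤n))
        (h₂ m n (ℕ.m⊔n≤o⇒n≤o N₁ N₂ N≤m) (ℕ.m⊔n≤o⇒n≤o N₁ N₂ N≤n))))

-_ : ℝ → ℝ
- x = mkℝ (λ n → ℚ.- seq x n) λ ε ε>0 →
  let N , h = cauchy x ε ε>0
  in N , λ m n N≤m N≤n →
    subst (ℚ._< ε) (sym (∣∣-sub-neg (seq x m) (seq x n))) (h m n N≤m N≤n)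

_-_ : ℝ → ℝ → ℝ
x - y = x + (- y)

∣_∣ : ℝ → ℝ
∣ x ∣ = mkℝ (λ n → ℚ.∣ seq x n ∣) λ ε ε>0 →
  let N , h = cauchy x ε ε>0
  in N , λ m n N≤m N≤n →
    ℚ.≤-<-trans (∣∣-sub-∣∣ (seq x m) (seq x n)) (h m n N≤m N≤n)

------------------------------------------------------------------------
-- Non-negative reals

record ℝ⁺ : Set where
  constructor mkℝ⁺
  field
    val    : ℝ
    nonneg : 0ℝ ≤ val

open ℝ⁺ public

infix 4 _≃⁺_ _≤⁺_ _<⁺_

_≃⁺_ _≤⁺_ _<⁺_ : ℝ⁺ → ℝ⁺ → Set
x ≃⁺ y = val x ≃ val y
x ≤⁺ y = val x ≤ val y
x <⁺ y = val x < val y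

0⁺ : ℝ⁺
0⁺ = mkℝ⁺ 0ℝ λ ε ε>0 → 0 , λ _ _ → subst (0ℚ ℚ.<_) (sym (ℚ.+-identityˡ ε)) ε>0

infixl 6 _+⁺_

_+⁺_ : ℝ⁺ → ℝ⁺ → ℝ⁺
x +⁺ y = mkℝ⁺ (val x + val y) λ ε ε>0 →
  let N₁ , h₁ = nonneg x (½ ℚ.* ε) (half>0 ε>0)
      N₂ , h₂ = nonneg y (½ ℚ.* ε) (half>0 ε>0)
  in N₁ ℕ.⊔ N₂ , λ n N≤n →
    subst (0ℚ ℚ.<_)
      (trans (interchange (seq (val x) n) (½ ℚ.* ε) (seq (val y) n) (½ ℚ.* ε))
             (cong ((seq (val x) n ℚ.+ seq (val y) n) ℚ.+_) (half+half ε)))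
      (ℚ.+-mono-< (h₁ n (ℕ.m⊔n≤o⇒m≤o N₁ N₂ N≤n)) (h₂ n (ℕ.m⊔n≤o⇒n≤o N₁ N₂ N≤n)))

sum⁺ : List ℝ⁺ → ℝ⁺
sum⁺ = List.foldr _+⁺_ 0⁺

Continuous : (ℝ⁺ → ℝ⁺) → Set
Continuous f = ∀ x ε → 0ℝ < ε → ∃ λ δ → 0ℝ < δ ×
  (∀ y → ∣ val y - val x ∣ < δ → ∣ val (f y) - val (f x) ∣ < ε)

NonDecreasing : (ℝ⁺ → ℝ⁺) → Set
NonDecreasing f = ∀ x y → x ≤⁺ y → f x ≤⁺ f y

------------------------------------------------------------------------
-- Multi-digraphs and paths

record MultiDigraph : Set where
  field
    #nodes #edges : ℕ

  Node : Set
  Node = Fin #nodes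

  Edge : Set
  Edge = Fin #edges

  field
    src tgt : Edge → Node

module Paths (Γ : MultiDigraph) where
  open MultiDigraph Γ

  infixr 5 _∷⟨_⟩_

  data Path : Node → Node → Set where
    []     : ∀ {u} → Path u u
    _∷⟨_⟩_ : ∀ {u v} (e : Edge) → src e ≡ u → Path (tgt e) v → Path u v

  nodes : ∀ {u v} → Path u v → List Node
  nodes {u} []           = u ∷ []
  nodes {u} (e ∷⟨ _ ⟩ p) = u ∷ nodes p

  edges : ∀ {u v} → Path u v → List Edge
  edges []           = []
  edges (e ∷⟨ _ ⟩ p) = e ∷ edges p

  Simple : ∀ {u v} → Path u v → Set
  Simple p = Unique (nodes p)

  simple? : ∀ {u v} (p : Path u v) → Dec (Simple p)
  simple? p = DecUnique.unique? Fin._≟_ (nodes p)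

  -- Simplicity is decidable, so nothing is lost by making its proof
  -- irrelevant, and two simple paths are equal as soon as the paths are.
  record SimplePath (u v : Node) : Set where
    constructor mkSimple
    field
      path    : Path u v
      .simple : Simple path

  open SimplePath public

  simple! : ∀ {u v} (p : SimplePath u v) → Simple (path p)
  simple! (mkSimple p sp) = recompute (simple? p) sp

  private
    open UIP.Decidable⇒UIP (Fin._≟_ {#nodes}) using (≡-irrelevant)

    nil : ∀ u v → List (Path u v)
    nil u v with u Fin.≟ v
    ... | yes refl = [] ∷ []
    ... | no _     = []

    extend : ∀ {u v} e → List (Path (tgt e) v) → List (Path u v)
    extend {u} e ps with src e Fin.≟ u
    ... | yes eq = List.map (e ∷⟨ eq ⟩_) ps
    ... | no _   = []

    simples : ∀ {u v} → List (Path u v) → List (SimplePath u v)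
    simples []       = []
    simples (p ∷ ps) with simple? p
    ... | yes sp = mkSimple p sp ∷ simples ps
    ... | no _   = simples ps

  -- All paths with at most the given number of edges.
  pathsUpTo : ℕ → ∀ u v → List (Path u v)
  pathsUpTo zero    u v = nil u v
  pathsUpTo (suc k) u v =
    nil u v ++ List.concatMap (λ e → extend e (pathsUpTo k (tgt e) v)) (List.allFin #edges)

  -- A complete duplicate-free enumeration: see ∈-simplePaths and
  -- simplePaths-unique below.
  simplePaths : ∀ u v → List (SimplePath u v)
  simplePaths u v = simples (pathsUpTo #nodes u v)

  private
    nil-complete : ∀ u → [] ∈ nil u u
    nil-complete u with u Fin.≟ u
    ... | yes refl = here refl
    ... | no u≢u   = contradiction refl u≢u

    extend-complete : ∀ {u v} e (eq : src e ≡ u) {p : Path (tgt e) v} {ps} →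
                      p ∈ ps → e ∷⟨ eq ⟩ p ∈ extend e ps
    extend-complete {u} e eq p∈ps with src e Fin.≟ u
    ... | yes eq′ rewrite ≡-irrelevant eq eq′ = ∈-map⁺ (e ∷⟨ eq′ ⟩_) p∈ps
    ... | no neq  = contradiction eq neq

    pathsUpTo-complete : ∀ k {u v} (p : Path u v) →
                         length (edges p) ℕ.≤ k → p ∈ pathsUpTo k u v
    pathsUpTo-complete zero    {u} []              _           = nil-complete u
    pathsUpTo-complete (suc k) {u} []              _           = ∈-++⁺ˡ (nil-complete u)
    pathsUpTo-complete (suc k) {u} {v} (e ∷⟨ eq ⟩ p) (ℕ.s≤s le) =
      ∈-++⁺ʳ (nil u v) (∈-concatMap⁺ (λ e → extend e (pathsUpTo k (tgt e) v))
        (Any.map (λ { refl → extend-complete e eq (pathsUpTo-complete k p le) })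
                 (∈-allFin e)))

    simples-complete : ∀ {u v} (p : SimplePath u v) {ps} → path p ∈ ps → p ∈ simples ps
    simples-complete p@(mkSimple q _) {q ∷ ps} (here refl) with simple? q
    ... | yes _  = here refl
    ... | no ¬sp = contradiction (simple! p) ¬sp
    simples-complete p {q ∷ ps} (there p∈ps) with simple? q
    ... | yes _ = there (simples-complete p p∈ps)
    ... | no _  = simples-complete p p∈ps

    length-nodes : ∀ {u v} (p : Path u v) → length (nodes p) ≡ suc (length (edges p))
    length-nodes []           = refl
    length-nodes (e ∷⟨ _ ⟩ p) = cong suc (length-nodes p)

    lookup-injective : ∀ {n} {xs : List (Fin n)} → Unique xs →
                       Injective _≡_ _≡_ (lookup xs)
    lookup-injective (x≢ ∷ un) {zero}  {zero}  eq = refl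
    lookup-injective (x≢ ∷ un) {zero}  {suc j} eq =
      contradiction eq (All.lookup x≢ (∈-lookup j))
    lookup-injective (x≢ ∷ un) {suc i} {zero}  eq =
      contradiction (sym eq) (All.lookup x≢ (∈-lookup i))
    lookup-injective (x≢ ∷ un) {suc i} {suc j} eq = cong suc (lookup-injective un eq)

  ∈-simplePaths : ∀ {u v} (p : SimplePath u v) → p ∈ simplePaths u v
  ∈-simplePaths p = simples-complete p (pathsUpTo-complete #nodes (path p)
    (ℕ.≤-trans (ℕ.n≤1+n _) (subst (ℕ._≤ #nodes) (length-nodes (path p))
      (Fin.injective⇒≤ (lookup-injective (simple! p))))))

  private
    data StartsWith (e : Edge) : ∀ {u v} → Path u v → Set where
      starts : ∀ {u v} {eq : src e ≡ u} {p : Path (tgt e) v} → StartsWith e (e ∷⟨ eq ⟩ p)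

    nil-unique : ∀ u v → Unique (nil u v)
    nil-unique u v with u Fin.≟ v
    ... | yes refl = [] ∷ []
    ... | no _     = []

    extend-unique : ∀ {u v} e {ps : List (Path (tgt e) v)} →
                    Unique ps → Unique (extend {u} e ps)
    extend-unique {u} e un with src e Fin.≟ u
    ... | yes _ = Unique.map⁺ (λ { refl → refl }) un
    ... | no _  = []

    extend-starts : ∀ {u v} e (ps : List (Path (tgt e) v)) {p : Path u v} →
                    p ∈ extend e ps → StartsWith e p
    extend-starts {u} e ps p∈ with src e Fin.≟ u
    ... | yes eq with _ , _ , refl ← ∈-map⁻ (e ∷⟨ eq ⟩_) p∈ = starts

    starts-functional : ∀ {e f u v} {p : Path u v} →
                        StartsWith e p → StartsWith f p → e ≡ f
    starts-functional starts starts = refl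

    nil-starts : ∀ {e u v} {p : Path u v} → p ∈ nil u v → ¬ StartsWith e p
    nil-starts {u = u} {v} p∈ st with u Fin.≟ v
    nil-starts (here refl) () | yes refl

    concat-starts : ∀ {u v} (f : ∀ e → List (Path (tgt e) v)) es {p : Path u v} →
                    p ∈ List.concatMap (λ e → extend e (f e)) es → ∃ λ e → StartsWith e p
    concat-starts f (e ∷ es) p∈ with ∈-++⁻ (extend e (f e)) p∈
    ... | inj₁ p∈₁ = e , extend-starts e (f e) p∈₁
    ... | inj₂ p∈₂ = concat-starts f es p∈₂

    pathsUpTo-unique : ∀ k u v → Unique (pathsUpTo k u v)
    pathsUpTo-unique zero    u v = nil-unique u v
    pathsUpTo-unique (suc k) u v = Unique.++⁺ (nil-unique u v)
      (Unique.concat⁺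
        (All.map⁺ (All.universal
          (λ e → extend-unique e (pathsUpTo-unique k (tgt e) v)) (List.allFin #edges)))
        (AllPairs.map⁺ (AllPairs.map
          (λ { {e} {f} e≢f (p∈e , p∈f) → e≢f (starts-functional
             (extend-starts e (rest e) p∈e) (extend-starts f (rest f) p∈f)) })
          (Unique.allFin⁺ #edges))))
      (λ (p∈nil , p∈ext) →
        nil-starts p∈nil (proj₂ (concat-starts rest (List.allFin #edges) p∈ext)))
      where
      rest : ∀ e → List (Path (tgt e) v)
      rest e = pathsUpTo k (tgt e) v

    simples-∉ : ∀ {u v} (p : SimplePath u v) ps → All (path p ≢_) ps → All (p ≢_) (simples ps)
    simples-∉ p []       []         = []
    simples-∉ p (q ∷ ps) (p≢q ∷ p≢) with simple? q
    ... | yes _ = (λ { refl → p≢q refl }) ∷ simples-∉ p ps p≢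
    ... | no _  = simples-∉ p ps p≢

    simples-unique : ∀ {u v} (ps : List (Path u v)) → Unique ps → Unique (simples ps)
    simples-unique []       []        = []
    simples-unique (p ∷ ps) (p≢ ∷ un) with simple? p
    ... | yes sp = simples-∉ (mkSimple p sp) ps p≢ ∷ simples-unique ps un
    ... | no _   = simples-unique ps un

  simplePaths-unique : ∀ u v → Unique (simplePaths u v)
  simplePaths-unique u v =
    simples-unique (pathsUpTo #nodes u v) (pathsUpTo-unique #nodes u v)

------------------------------------------------------------------------
-- Nets

record Net : Set where
  field
    graph : MultiDigraph

  open MultiDigraph graph public
  open Paths graph public

  field
    s t : Node

  STPath : Set
  STPath = Path s t

  SP : Set
  SP = SimplePath s t

  allSP : List SP
  allSP = simplePaths s t

  through : Edge → List SP
  through e = List.filter (λ p → e ∈? edges (path p)) allSP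
    where open DecMembership Fin._≟_ using (_∈?_)

STConnected : Net → Set
STConnected G = ∀ v → Σ STPath λ p → v ∈ nodes p
  where open Net G

record Latency (G : Net) : Set where
  open Net G
  field
    fun           : Edge → ℝ⁺ → ℝ⁺
    continuous    : ∀ e → Continuous (fun e)
    nonDecreasing : ∀ e → NonDecreasing (fun e)

module _ (G : Net) where
  open Net G

  Flow : Set
  Flow = SP → ℝ⁺

  value : Flow → ℝ⁺
  value φ = sum⁺ (List.map φ allSP)

  edgeFlow : Flow → Edge → ℝ⁺
  edgeFlow φ e = sum⁺ (List.map φ (through e))

  pathLatency : Latency G → Flow → STPath → ℝ⁺
  pathLatency l φ p =
    sum⁺ (List.map (λ e → Latency.fun l e (edgeFlow φ e)) (edges p))

  -- Only simple paths carry flow, so p need only range over SP; the competing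
  -- path q is arbitrary.
  IsWardrop : ℝ⁺ → Latency G → Flow → Set
  IsWardrop r l φ = value φ ≃⁺ r ×
    (∀ (p : SP) (q : STPath) → 0⁺ <⁺ φ p →
       pathLatency l φ (path p) ≤⁺ pathLatency l φ q)

  -- The graph of the partial function L: it holds of x when L(G,r,l) is x.
  -- The value does not depend on the Wardrop flow, so one flow is exhibited.
  IsL : ℝ⁺ → Latency G → ℝ⁺ → Set
  IsL r l x =
      (r ≃⁺ 0⁺ × x ≃⁺ 0⁺)
    ⊎ (0⁺ <⁺ r × Σ Flow λ φ → IsWardrop r l φ ×
         (∀ (p : SP) → 0⁺ <⁺ φ p → pathLatency l φ (path p) ≃⁺ x))

-- Subgraphs with the same source and target, up to isomorphism: as nodes and
-- edges are initial segments of ℕ, sub-collections of them are injections.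
record Subnet (G : Net) : Set where
  field
    net : Net

  private
    module G = Net G
    module H = Net net

  field
    node           : H.Node → G.Node
    edge           : H.Edge → G.Edge
    node-injective : Injective _≡_ _≡_ node
    edge-injective : Injective _≡_ _≡_ edge
    src-edge       : ∀ e → G.src (edge e) ≡ node (H.src e)
    tgt-edge       : ∀ e → G.tgt (edge e) ≡ node (H.tgt e)
    source         : node H.s ≡ G.s
    target         : node H.t ≡ G.t

  restrict : Latency G → Latency net
  restrict l = record
    { fun           = λ e → Latency.fun l (edge e)
    ; continuous    = λ e → Latency.continuous l (edge e)
    ; nonDecreasing = λ e → Latency.nonDecreasing l (edge e)
    }

Vulnerable : Net → Set
Vulnerable G =
  Σ ℝ⁺ λ r → Σ (Latency G) λ l → Σ (Subnet G) λ H →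
    Net.STPath (Subnet.net H) ×
    ∃ λ x → ∃ λ y →
      IsL G r l x × IsL (Subnet.net H) r (Subnet.restrict H l) y × y <⁺ x

------------------------------------------------------------------------
-- The Wheatstone graph and its st-embeddings

private
  pattern a = zero
  pattern b = suc zero
  pattern c = suc (suc zero)
  pattern d = suc (suc (suc zero))

𝒲 : MultiDigraph
𝒲 = record
  { #nodes = 4
  ; #edges = 5
  ; src    = Vec.lookup (a Vec.∷ a Vec.∷ b Vec.∷ b Vec.∷ c Vec.∷ Vec.[])
  ; tgt    = Vec.lookup (b Vec.∷ c Vec.∷ c Vec.∷ d Vec.∷ d Vec.∷ Vec.[])
  }

private module W = MultiDigraph 𝒲

_EndpointOf_ : W.Node → W.Edge → Set
x EndpointOf e = x ≡ W.src e ⊎ x ≡ W.tgt e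

record STEmbedding (G : Net) : Set where
  open Net G
  field
    ϕ           : W.Node → Node
    ϕ-injective : Injective _≡_ _≡_ ϕ

    ψ           : ∀ e → SimplePath (ϕ (W.src e)) (ϕ (W.tgt e))

  ψ′ : W.Edge → Σ Node λ u → Σ Node λ v → SimplePath u v
  ψ′ e = ϕ (W.src e) , ϕ (W.tgt e) , ψ e

  field
    ψ-injective : Injective _≡_ _≡_ ψ′
    ψ-disjoint  : ∀ e f → e ≢ f → ∀ v →
                  v ∈ nodes (path (ψ e)) → v ∈ nodes (path (ψ f)) →
                  ∃ λ x → v ≡ ϕ x × x EndpointOf e × x EndpointOf f

    head          : SimplePath s (ϕ a)
    tail          : SimplePath (ϕ d) t
    head-tail     : ∀ v → v ∈ nodes (path head) → v ∉ nodes (path tail)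
    head-disjoint : ∀ e v → v ∈ nodes (path head) → v ∈ nodes (path (ψ e)) → v ≡ ϕ a
    tail-disjoint : ∀ e v → v ∈ nodes (path tail) → v ∈ nodes (path (ψ e)) → v ≡ ϕ d

{-# OPTIONS --safe #-}

-- Embedding to vulnerability: Braess' paradox is built on the embedded copy of
-- the Wheatstone graph.  Every node gets the region of a corner, and the
-- latency of an edge is the height difference between its regions, except
-- that it is the identity where the sides AB and CD leave their first corner.
-- Two units along ABCD have latency 4; once all edges from region B to region C
-- are deleted, one unit on each of ABD and ACD has latency 3.  Potentials on the
-- regions bound the latencies of all competing walks from below.
--
-- Vulnerability to embedding: call G crossed if some simple st-path visits w
-- before z, while disjoint paths lead from s to z and from w to t.  Consecutive
-- visits of these two paths to the first one give two interleaved ears, hence a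
-- Wheatstone graph.  Let φ and χ be Wardrop flows of G and of a subnet H, and let
-- S be the set of nodes reachable from s through edges that carry χ and on which
-- φ ≤ χ.  If t ∈ S, then a path through such edges shows that the latency of φ is
-- at most that of χ.  Otherwise let T be the set of nodes that reach t outside S.
-- If G is not crossed, every simple st-path enters T exactly once, through an edge
-- that leaves S, so both flows have total r on those edges; but on each of them χ
-- vanishes or is smaller than φ.  Being crossed is decidable, which makes this
-- classical argument constructive.

module Submission where

open import Defs
import Algebra.Properties.CommutativeSemigroup as CommutativeSemigroupProperties
import Axiom.UniquenessOfIdentityProofs as UIP
open import Data.Empty using (⊥; ⊥-elim)
open import Data.Fin.Base using (Fin; zero; suc)
import Data.Fin.Properties as Fin
import Data.Integer.Base as ℤ
open import Data.List.Base as List using (List; []; _∷_; _++_)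
open import Data.List.Properties
  using (∷-injectiveˡ; ∷-injectiveʳ; ≡-dec; map-∘; filter-≐; filter-accept; filter-reject)
open import Data.List.Membership.Propositional using (_∈_; _∉_)
open import Data.List.Membership.Propositional.Properties
  using (∈-++⁺ˡ; ∈-++⁺ʳ; ∈-++⁻; ∈-map⁺; ∈-map⁻; ∈-filter⁺; ∈-filter⁻; ∈-allFin; ∈-lookup)
import Data.List.Membership.DecPropositional as DecMembership
open import Data.List.Relation.Binary.Subset.Propositional using (_⊆_)
open import Data.List.Relation.Unary.All as All using (All; []; _∷_)
import Data.List.Relation.Unary.All.Properties as All
open import Data.List.Relation.Unary.AllPairs using ([]; _∷_)
open import Data.List.Relation.Unary.Any as Any using (Any; here; there)
import Data.List.Relation.Unary.Any.Properties as Any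
open import Data.List.Relation.Unary.Unique.Propositional using (Unique)
import Data.List.Relation.Unary.Unique.Propositional.Properties as Unique
open import Data.Maybe.Base using (Maybe; just; nothing)
open import Data.Nat.Base as ℕ using (ℕ; zero; suc)
open import Data.Nat.ListAction using (sum)
import Data.Nat.Properties as ℕ
open import Data.Product.Base using (Σ; ∃; _×_; _,_; proj₁; proj₂)
open import Data.Rational.Base as ℚ using (ℚ; 0ℚ; ½)
import Data.Rational.Properties as ℚ
open import Data.Rational.Solver using (module +-*-Solver)
open import Data.Sum.Base as Sum using (_⊎_; inj₁; inj₂; [_,_]′)
open import Data.Unit.Base using (⊤; tt)
import Data.Vec.Base as Vec
open import Function.Base using (_∘_; id)
open import Function.Bundles using (_⇔_; mk⇔)
open import Function.Definitions using (Injective)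
open import Relation.Binary.Definitions using (Tri; tri<; tri≈; tri>)
open import Relation.Binary.PropositionalEquality
open import Relation.Nullary
open import Relation.Nullary.Decidable
  using (map′; _×-dec_; _⊎-dec_; _→-dec_; ¬?; from-yes; decidable-stable)

open CommutativeSemigroupProperties ℕ.+-commutativeSemigroup
  using () renaming (interchange to +-interchange)

-- Real numbers

½>0 : ∀ {ε} → 0ℚ ℚ.< ε → 0ℚ ℚ.< ½ ℚ.* ε
½>0 {ε} ε>0 = subst (ℚ._< ½ ℚ.* ε) (ℚ.*-zeroʳ ½) (ℚ.*-monoʳ-<-pos ½ ε>0)

p<p+ε : ∀ p {ε} → 0ℚ ℚ.< ε → p ℚ.< p ℚ.+ ε
p<p+ε p {ε} ε>0 = subst (ℚ._< p ℚ.+ ε) (ℚ.+-identityʳ p) (ℚ.+-monoʳ-< p ε>0)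

module _ where
  open +-*-Solver

  +½ε+½ε : ∀ p ε → (p ℚ.+ ½ ℚ.* ε) ℚ.+ ½ ℚ.* ε ≡ p ℚ.+ ε
  +½ε+½ε = solve 2 (λ p ε → (p :+ con ½ :* ε) :+ con ½ :* ε := p :+ ε) refl

  +½ε-interchange : ∀ p q ε →
    (p ℚ.+ ½ ℚ.* ε) ℚ.+ (q ℚ.+ ½ ℚ.* ε) ≡ (p ℚ.+ q) ℚ.+ ε
  +½ε-interchange =
    solve 3 (λ p q ε → (p :+ con ½ :* ε) :+ (q :+ con ½ :* ε) := (p :+ q) :+ ε) refl

  +-right-comm : ∀ p q r → (p ℚ.+ q) ℚ.+ r ≡ (p ℚ.+ r) ℚ.+ q
  +-right-comm = solve 3 (λ p q r → (p :+ q) :+ r := (p :+ r) :+ q) refl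

  p-q+q : ∀ p q → (p ℚ.- q) ℚ.+ q ≡ p
  p-q+q = solve 2 (λ p q → (p :- q) :+ q := p) refl

  p+q-q : ∀ p q → (p ℚ.+ q) ℚ.- q ≡ p
  p+q-q = solve 2 (λ p q → (p :+ q) :- q := p) refl

  close-left : ∀ p q r → (q ℚ.+ (p ℚ.- q)) ℚ.+ (r ℚ.- p) ≡ r
  close-left = solve 3 (λ p q r → (q :+ (p :- q)) :+ (r :- p) := r) refl

  close-right : ∀ p p′ r θ → (((p ℚ.+ θ) ℚ.+ θ) ℚ.+ ((p′ ℚ.- r) ℚ.+ θ)) ℚ.+ (r ℚ.- p)
                             ≡ ((p′ ℚ.+ θ) ℚ.+ θ) ℚ.+ θ
  close-right = solve 4 (λ p p′ r θ → (((p :+ θ) :+ θ) :+ ((p′ :- r) :+ θ)) :+ (r :- p)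
                                      := ((p′ :+ θ) :+ θ) :+ θ) refl

  far-left : ∀ p p′ r θ →
    (((p ℚ.+ θ) ℚ.+ θ) ℚ.+ (p′ ℚ.- r)) ℚ.+ ((r ℚ.- p) ℚ.- θ) ≡ p′ ℚ.+ θ
  far-left = solve 4 (λ p p′ r θ → (((p :+ θ) :+ θ) :+ (p′ :- r)) :+ ((r :- p) :- θ)
                                   := p′ :+ θ) refl

  far-right : ∀ p q r θ → (q ℚ.+ ((p ℚ.- q) ℚ.+ θ)) ℚ.+ ((r ℚ.- p) ℚ.- θ) ≡ r
  far-right = solve 4 (λ p q r θ → (q :+ ((p :- q) :+ θ)) :+ ((r :- p) :- θ) := r) refl

p≤∣p∣ : ∀ p → p ℚ.≤ ℚ.∣ p ∣
p≤∣p∣ p with ℚ.∣p∣≡p∨∣p∣≡-p p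
... | inj₁ eq = ℚ.≤-reflexive (sym eq)
... | inj₂ eq with ℚ.≤-total 0ℚ p
...   | inj₁ 0≤p = ℚ.≤-reflexive (sym (ℚ.0≤p⇒∣p∣≡p 0≤p))
...   | inj₂ p≤0 = ℚ.≤-trans p≤0 (ℚ.0≤∣p∣ p)

∣p-q∣≡∣q-p∣ : ∀ p q → ℚ.∣ p ℚ.- q ∣ ≡ ℚ.∣ q ℚ.- p ∣
∣p-q∣≡∣q-p∣ p q = trans (sym (ℚ.∣-p∣≡∣p∣ (p ℚ.- q))) (cong ℚ.∣_∣ (neg-sub p q))
  where
  open +-*-Solver
  neg-sub : ∀ p q → ℚ.- (p ℚ.- q) ≡ q ℚ.- p
  neg-sub = solve 2 (λ p q → :- (p :- q) := q :- p) refl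

∣p-q∣<ε⇒p<q+ε : ∀ p q {ε} → ℚ.∣ p ℚ.- q ∣ ℚ.< ε → p ℚ.< q ℚ.+ ε
∣p-q∣<ε⇒p<q+ε p q {ε} h = subst₂ ℚ._<_ (p-q+q p q) (ℚ.+-comm ε q)
  (ℚ.+-monoˡ-< q (ℚ.≤-<-trans (p≤∣p∣ (p ℚ.- q)) h))

eventually₂ : ∀ {P Q R : ℕ → Set} → (∀ n → P n → Q n → R n) →
              Eventually P → Eventually Q → Eventually R
eventually₂ f (N , h) (M , k) = N ℕ.⊔ M , λ n le →
  f n (h n (ℕ.m⊔n≤o⇒m≤o N M le)) (k n (ℕ.m⊔n≤o⇒n≤o N M le))

infix 4 _≐_

-- Equality term by term, finer than `_≃_`. The identities between sums below hold in this strong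
-- form, so they reduce to identities in `ℚ` without estimates.
_≐_ : ℝ → ℝ → Set
x ≐ y = ∀ n → seq x n ≡ seq y n

≐⇒≤ : ∀ x y → x ≐ y → x ≤ y
≐⇒≤ x y eq ε ε>0 = 0 , λ n _ →
  subst (λ p → seq x n ℚ.< p ℚ.+ ε) (eq n) (p<p+ε (seq x n) ε>0)

≐⇒≃ : ∀ x y → x ≐ y → x ≃ y
≐⇒≃ x y eq ε ε>0 = 0 , λ n _ → subst (ℚ._< ε)
  (sym (cong ℚ.∣_∣ (trans (cong (ℚ._- seq y n) (eq n)) (ℚ.+-inverseʳ (seq y n))))) ε>0

≃⇒≤ : ∀ x y → x ≃ y → x ≤ y
≃⇒≤ x y x≃y ε ε>0 with N , h ← x≃y ε ε>0 =
  N , λ n N≤n → ∣p-q∣<ε⇒p<q+ε (seq x n) (seq y n) (h n N≤n)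

≃⇒≥ : ∀ x y → x ≃ y → y ≤ x
≃⇒≥ x y x≃y = ≃⇒≤ y x λ ε ε>0 → let N , h = x≃y ε ε>0 in
  N , λ n N≤n → subst (ℚ._< ε) (∣p-q∣≡∣q-p∣ (seq x n) (seq y n)) (h n N≤n)

≤-refl : ∀ x → x ≤ x
≤-refl x = ≐⇒≤ x x λ _ → refl

≤-trans : ∀ x y z → x ≤ y → y ≤ z → x ≤ z
≤-trans x y z x≤y y≤z ε ε>0 = eventually₂
  (λ n h k → subst (seq x n ℚ.<_) (+½ε+½ε (seq z n) ε)
     (ℚ.<-trans h (ℚ.+-monoˡ-< (½ ℚ.* ε) k)))
  (x≤y (½ ℚ.* ε) (½>0 ε>0)) (y≤z (½ ℚ.* ε) (½>0 ε>0))

<⇒≤ : ∀ x y → x < y → x ≤ y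
<⇒≤ x y (δ , δ>0 , N , h) ε ε>0 = N , λ n N≤n →
  ℚ.<-trans (p<p+ε (seq x n) δ>0) (ℚ.<-trans (h n N≤n) (p<p+ε (seq y n) ε>0))

≤-<-trans : ∀ x y z → x ≤ y → y < z → x < z
≤-<-trans x y z x≤y (ε , ε>0 , y<z) = ½ ℚ.* ε , ½>0 ε>0 , eventually₂
  (λ n h k → ℚ.<-trans
     (subst (seq x n ℚ.+ ½ ℚ.* ε ℚ.<_) (+½ε+½ε (seq y n) ε) (ℚ.+-monoˡ-< (½ ℚ.* ε) h)) k)
  (x≤y (½ ℚ.* ε) (½>0 ε>0)) y<z

<-≤-trans : ∀ x y z → x < y → y ≤ z → x < z
<-≤-trans x y z (ε , ε>0 , x<y) y≤z = ½ ℚ.* ε , ½>0 ε>0 , eventually₂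
  (λ n h k → +-cancelʳ-<ℚ (½ ℚ.* ε)
     (subst (ℚ._< seq z n ℚ.+ ½ ℚ.* ε) (sym (+½ε+½ε (seq x n) ε)) (ℚ.<-trans h k)))
  x<y (y≤z (½ ℚ.* ε) (½>0 ε>0))
  where
  +-cancelʳ-<ℚ : ∀ r {p q} → p ℚ.+ r ℚ.< q ℚ.+ r → p ℚ.< q
  +-cancelʳ-<ℚ r {p} {q} h = subst₂ ℚ._<_ (p+q-q p r) (p+q-q q r) (ℚ.+-monoˡ-< (ℚ.- r) h)

≤⇒≯ : ∀ x y → x ≤ y → ¬ y < x
≤⇒≯ x y x≤y (ε , ε>0 , M , k) with N , h ← x≤y ε ε>0 =
  ℚ.<-asym (h (N ℕ.⊔ M) (ℕ.m≤m⊔n N M)) (k (N ℕ.⊔ M) (ℕ.m≤n⊔m N M))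

-- From some index N on, x - y varies by less than θ, a quarter of ε. Comparing the rationals at N
-- with slack 2θ either keeps y below x + 3θ from there on or separates x from y by θ, against the
-- hypothesis. Hence `_≤_` may be proved by contradiction.
≮⇒≥ : ∀ x y → ¬ x < y → y ≤ x
≮⇒≥ x y x≮y ε ε>0 = below (cauchy (x - y) θ θ>0)
  where
  θ = ½ ℚ.* (½ ℚ.* ε)

  θ>0 : 0ℚ ℚ.< θ
  θ>0 = ½>0 (½>0 ε>0)

  4θ≡ε : ∀ p → (((p ℚ.+ θ) ℚ.+ θ) ℚ.+ θ) ℚ.+ θ ≡ p ℚ.+ ε
  4θ≡ε p = trans (+½ε+½ε ((p ℚ.+ θ) ℚ.+ θ) (½ ℚ.* ε))
    (trans (cong (ℚ._+ ½ ℚ.* ε) (+½ε+½ε p (½ ℚ.* ε))) (+½ε+½ε p ε))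

  below : (∃ λ N → ∀ m n → N ℕ.≤ m → N ℕ.≤ n →
             ℚ.∣ seq (x - y) m ℚ.- seq (x - y) n ∣ ℚ.< θ) →
          Eventually λ n → seq y n ℚ.< seq x n ℚ.+ ε
  below (N , h) with seq y N ℚ.<? (seq x N ℚ.+ θ) ℚ.+ θ
  ... | yes y<x = N , λ n N≤n → ℚ.<-trans
    (subst₂ ℚ._<_ (close-left (seq x N) (seq y N) (seq y n))
       (close-right (seq x N) (seq x n) (seq y n) θ)
       (ℚ.+-monoˡ-< (seq y n ℚ.- seq x N)
         (ℚ.+-mono-< y<x (∣p-q∣<ε⇒p<q+ε (seq (x - y) N) (seq (x - y) n) (h N n ℕ.≤-refl N≤n)))))
    (subst (((seq x n ℚ.+ θ) ℚ.+ θ) ℚ.+ θ ℚ.<_) (4θ≡ε (seq x n))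
       (p<p+ε (((seq x n ℚ.+ θ) ℚ.+ θ) ℚ.+ θ) θ>0))
  ... | no y≮x = contradiction
    ( θ , θ>0 , N , λ n N≤n →
      subst₂ ℚ._<_ (far-left (seq x N) (seq x n) (seq y n) θ)
        (far-right (seq x N) (seq y N) (seq y n) θ)
        (ℚ.+-monoˡ-< ((seq y n ℚ.- seq x N) ℚ.- θ)
          (ℚ.+-mono-≤-< (ℚ.≮⇒≥ y≮x)
            (∣p-q∣<ε⇒p<q+ε (seq (x - y) n) (seq (x - y) N) (h n N N≤n ℕ.≤-refl)))))
    x≮y

+-mono-≤ : ∀ x y u v → x ≤ y → u ≤ v → x + u ≤ y + v
+-mono-≤ x y u v x≤y u≤v ε ε>0 = eventually₂
  (λ n h k → subst (seq x n ℚ.+ seq u n ℚ.<_) (+½ε-interchange (seq y n) (seq v n) ε)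
     (ℚ.+-mono-< h k))
  (x≤y (½ ℚ.* ε) (½>0 ε>0)) (u≤v (½ ℚ.* ε) (½>0 ε>0))

+-mono-<-≤ : ∀ x y u v → x < y → u ≤ v → x + u < y + v
+-mono-<-≤ x y u v x<y u≤v = <-≤-trans (x + u) (y + u) (y + v)
  (let ε , ε>0 , N , h = x<y in ε , ε>0 , N , λ n N≤n →
     subst (ℚ._< seq y n ℚ.+ seq u n) (+-right-comm (seq x n) ε (seq u n))
       (ℚ.+-monoˡ-< (seq u n) (h n N≤n)))
  (+-mono-≤ y y u v (≤-refl y) u≤v)

+-mono-≤-< : ∀ x y u v → x ≤ y → u < v → x + u < y + v
+-mono-≤-< x y u v x≤y u<v = <-≤-trans (x + u) (v + y) (y + v)
  (≤-<-trans (x + u) (u + x) (v + y)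
    (≐⇒≤ (x + u) (u + x) λ n → ℚ.+-comm (seq x n) (seq u n))
    (+-mono-<-≤ u v x y u<v x≤y))
  (≐⇒≤ (v + y) (y + v) λ n → ℚ.+-comm (seq v n) (seq y n))

+-cancelˡ-≤ : ∀ x y z → x + y ≤ x + z → y ≤ z
+-cancelˡ-≤ x y z h ε ε>0 with N , k ← h ε ε>0 = N , λ n N≤n →
  +-cancelˡ-<ℚ (seq x n) (subst (seq x n ℚ.+ seq y n ℚ.<_)
    (ℚ.+-assoc (seq x n) (seq z n) ε) (k n N≤n))
  where
  open +-*-Solver
  -p+[p+q] : ∀ p q → ℚ.- p ℚ.+ (p ℚ.+ q) ≡ q
  -p+[p+q] = solve 2 (λ p q → :- p :+ (p :+ q) := q) refl
  +-cancelˡ-<ℚ : ∀ r {p q} → r ℚ.+ p ℚ.< r ℚ.+ q → p ℚ.< q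
  +-cancelˡ-<ℚ r {p} {q} lt = subst₂ ℚ._<_ (-p+[p+q] r p) (-p+[p+q] r q) (ℚ.+-monoʳ-< (ℚ.- r) lt)


+-≤0 : ∀ x y → x ≤ 0ℝ → y ≤ 0ℝ → x + y ≤ 0ℝ
+-≤0 x y x≤0 y≤0 = ≤-trans (x + y) (0ℝ + 0ℝ) 0ℝ (+-mono-≤ x 0ℝ y 0ℝ x≤0 y≤0)
  (≐⇒≤ (0ℝ + 0ℝ) 0ℝ λ _ → refl)

-- Since y and v are non-negative, a summand that is at most 0 is also at most its counterpart, so
-- one strict drop makes the whole sum drop.
+-drop : ∀ x y u v → val x ≤ 0ℝ ⊎ val x < val y → val u ≤ 0ℝ ⊎ val u < val v →
         val x + val u ≤ 0ℝ ⊎ val x + val u < val y + val v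
+-drop x y u v (inj₁ x≤0) (inj₁ u≤0) = inj₁ (+-≤0 (val x) (val u) x≤0 u≤0)
+-drop x y u v (inj₁ x≤0) (inj₂ u<v) = inj₂ (+-mono-≤-< (val x) (val y) (val u) (val v)
  (≤-trans (val x) 0ℝ (val y) x≤0 (nonneg y)) u<v)
+-drop x y u v (inj₂ x<y) (inj₁ u≤0) = inj₂ (+-mono-<-≤ (val x) (val y) (val u) (val v)
  x<y (≤-trans (val u) 0ℝ (val v) u≤0 (nonneg v)))
+-drop x y u v (inj₂ x<y) (inj₂ u<v) = inj₂ (+-mono-<-≤ (val x) (val y) (val u) (val v)
  x<y (<⇒≤ (val u) (val v) u<v))

-- Finite sums of non-negative reals and double counting.

module _ {A : Set} where

  Σ⁺ : (A → ℝ⁺) → List A → ℝ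
  Σ⁺ f xs = val (sum⁺ (List.map f xs))

  sum⁺-mono : ∀ (f g : A → ℝ⁺) xs → (∀ {a} → a ∈ xs → val (f a) ≤ val (g a)) →
              Σ⁺ f xs ≤ Σ⁺ g xs
  sum⁺-mono f g []       h = ≤-refl 0ℝ
  sum⁺-mono f g (a ∷ xs) h = +-mono-≤ (val (f a)) (val (g a)) (Σ⁺ f xs) (Σ⁺ g xs)
    (h (here refl)) (sum⁺-mono f g xs (h ∘ there))

  sum⁺-≤0 : ∀ (f : A → ℝ⁺) xs → (∀ {a} → a ∈ xs → val (f a) ≤ 0ℝ) → Σ⁺ f xs ≤ 0ℝ
  sum⁺-≤0 f []       h = ≤-refl 0ℝ
  sum⁺-≤0 f (a ∷ xs) h = +-≤0 (val (f a)) (Σ⁺ f xs) (h (here refl)) (sum⁺-≤0 f xs (h ∘ there))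

  -- If no summand were positive, each would be at most 0 by `≮⇒≥`, and so would the sum. The doubly
  -- negated form suffices, as every use ends in a contradiction.
  sum⁺-positive : ∀ (f : A → ℝ⁺) xs → 0ℝ < Σ⁺ f xs →
                  ¬ ¬ ∃ λ a → a ∈ xs × 0ℝ < val (f a)
  sum⁺-positive f xs pos none = ≤⇒≯ (Σ⁺ f xs) 0ℝ
    (sum⁺-≤0 f xs λ {a} a∈ → ≮⇒≥ 0ℝ (val (f a)) λ 0<fa → none (a , a∈ , 0<fa)) pos

  sum⁺-drop : ∀ (f g : A → ℝ⁺) xs →
              (∀ {a} → a ∈ xs → val (f a) ≤ 0ℝ ⊎ val (f a) < val (g a)) →
              Σ⁺ f xs ≤ 0ℝ ⊎ Σ⁺ f xs < Σ⁺ g xs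
  sum⁺-drop f g []       h = inj₁ (≤-refl 0ℝ)
  sum⁺-drop f g (a ∷ xs) h = +-drop (f a) (g a) (sum⁺ (List.map f xs)) (sum⁺ (List.map g xs))
    (h (here refl)) (sum⁺-drop f g xs (h ∘ there))

  sum⁺-++ : ∀ (f : A → ℝ⁺) xs ys → Σ⁺ f (xs ++ ys) ≐
            Σ⁺ f xs + Σ⁺ f ys
  sum⁺-++ f []       ys n = sym (ℚ.+-identityˡ _)
  sum⁺-++ f (a ∷ xs) ys n =
    trans (cong (seq (val (f a)) n ℚ.+_) (sum⁺-++ f xs ys n)) (sym (ℚ.+-assoc (seq (val (f a)) n) _ _))

module _ {A B : Set} (R : B → A → Set) (R? : ∀ b a → Dec (R b a)) (w : A → ℝ⁺) where

  -- With edges for B, paths for A and incidence for R this is the edge flow. R stays abstract so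
  -- that the flow of a subnet can be counted on the edges of the whole net.
  load : List A → B → ℝ⁺
  load xs b = sum⁺ (List.map w (List.filter (R? b) xs))

  private
    total : List B → List A → ℝ
    total bs xs = Σ⁺ (load xs) bs

    load-accept : ∀ {b x} xs → R b x → load (x ∷ xs) b ≡ w x +⁺ load xs b
    load-accept {b} xs r = cong (sum⁺ ∘ List.map w) (filter-accept (R? b) r)

    load-reject : ∀ {b x} xs → ¬ R b x → load (x ∷ xs) b ≡ load xs b
    load-reject {b} xs ¬r = cong (sum⁺ ∘ List.map w) (filter-reject (R? b) ¬r)

    total-[] : ∀ bs → total bs [] ≐ 0ℝ
    total-[] []       n = refl
    total-[] (b ∷ bs) n = trans (ℚ.+-identityˡ _) (total-[] bs n)

    total-none : ∀ x xs bs → (∀ {b} → b ∈ bs → ¬ R b x) → total bs (x ∷ xs) ≐ total bs xs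
    total-none x xs []       none n = refl
    total-none x xs (b ∷ bs) none n = cong₂ ℚ._+_
      (cong (λ r → seq (val r) n) (load-reject xs (none (here refl))))
      (total-none x xs bs (none ∘ there) n)

    total-one : ∀ x xs bs → Unique bs → ∀ b → b ∈ bs → R b x →
                (∀ {b′} → b′ ∈ bs → R b′ x → b′ ≡ b) →
                total bs (x ∷ xs) ≐ val (w x) + total bs xs
    total-one x xs (b ∷ bs) (b∉ ∷ un) b (here refl) r only n = trans
      (cong₂ ℚ._+_ (cong (λ r → seq (val r) n) (load-accept xs r))
        (total-none x xs bs (λ b′∈ r′ → All.lookup b∉ b′∈ (sym (only (there b′∈) r′))) n))
      (ℚ.+-assoc (seq (val (w x)) n) (seq (val (load xs b)) n) _)
    total-one x xs (c ∷ bs) (c∉ ∷ un) b (there b∈) r only n = trans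
      (cong₂ ℚ._+_
        (cong (λ r → seq (val r) n)
          (load-reject xs λ r′ → All.lookup c∉ b∈ (only (here refl) r′)))
        (total-one x xs bs un b b∈ r (only ∘ there) n))
      (left-comm (seq (val (load xs c)) n) (seq (val (w x)) n) _)
      where
      open +-*-Solver
      left-comm : ∀ p q r → p ℚ.+ (q ℚ.+ r) ≡ q ℚ.+ (p ℚ.+ r)
      left-comm = solve 3 (λ p q r → p :+ (q :+ r) := q :+ (p :+ r)) refl

    total-∷ : ∀ bs → Unique bs → ∀ x xs →
      (∃ λ b → b ∈ bs × R b x × (∀ {b′} → b′ ∈ bs → R b′ x → b′ ≡ b)) →
      total bs (x ∷ xs) ≐ val (w x) + total bs xs
    total-∷ bs un x xs (b , b∈ , r , only) = total-one x xs bs un b b∈ r only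

  -- Double counting: each x adds its weight to the load of exactly one b. For a cut that every path
  -- meets in one edge, the flow across the cut is the value of the flow.
  load-total : ∀ bs → Unique bs → ∀ xs →
    (∀ x → ∃ λ b → b ∈ bs × R b x × (∀ {b′} → b′ ∈ bs → R b′ x → b′ ≡ b)) →
    Σ⁺ (load xs) bs ≐ Σ⁺ w xs
  load-total bs un []       one n = total-[] bs n
  load-total bs un (x ∷ xs) one n = begin
    seq (total bs (x ∷ xs)) n            ≡⟨ total-∷ bs un x xs (one x) n ⟩
    seq (val (w x)) n ℚ.+ seq (total bs xs) n
      ≡⟨ cong (seq (val (w x)) n ℚ.+_) (load-total bs un xs one n) ⟩
    seq (val (w x)) n ℚ.+ seq (Σ⁺ w xs) n  ∎
    where open ≡-Reasoning

-- Natural numbers as non-negative reals.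

natℚ : ℕ → ℚ
natℚ zero    = 0ℚ
natℚ (suc n) = ℚ.1ℚ ℚ.+ natℚ n

natℚ-+ : ∀ m n → natℚ (m ℕ.+ n) ≡ natℚ m ℚ.+ natℚ n
natℚ-+ zero    n = sym (ℚ.+-identityˡ (natℚ n))
natℚ-+ (suc m) n = trans (cong (ℚ.1ℚ ℚ.+_) (natℚ-+ m n)) (sym (ℚ.+-assoc ℚ.1ℚ (natℚ m) (natℚ n)))

0≤natℚ : ∀ n → 0ℚ ℚ.≤ natℚ n
0≤natℚ zero    = ℚ.≤-refl
0≤natℚ (suc n) = ℚ.+-mono-≤ (ℚ.nonNegative⁻¹ ℚ.1ℚ) (0≤natℚ n)

natℚ-mono : ∀ {m n} → m ℕ.≤ n → natℚ m ℚ.≤ natℚ n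
natℚ-mono {n = n} ℕ.z≤n   = 0≤natℚ n
natℚ-mono (ℕ.s≤s m≤n) = ℚ.+-monoʳ-≤ ℚ.1ℚ (natℚ-mono m≤n)

fromℚ-mono-≤ : ∀ {p q} → p ℚ.≤ q → fromℚ p ≤ fromℚ q
fromℚ-mono-≤ {q = q} p≤q ε ε>0 = 0 , λ _ _ → ℚ.≤-<-trans p≤q (p<p+ε q ε>0)

nat⁺ : ℕ → ℝ⁺
nat⁺ n = mkℝ⁺ (fromℚ (natℚ n)) (fromℚ-mono-≤ (0≤natℚ n))

nat⁺-mono : ∀ {m n} → m ℕ.≤ n → nat⁺ m ≤⁺ nat⁺ n
nat⁺-mono m≤n = fromℚ-mono-≤ (natℚ-mono m≤n)

nat⁺-suc : ∀ n → nat⁺ n <⁺ nat⁺ (suc n)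
nat⁺-suc n = ½ , ℚ.positive⁻¹ ½ , 0 , λ _ _ →
  subst (ℚ._< natℚ (suc n)) (ℚ.+-comm ½ (natℚ n))
    (ℚ.+-monoˡ-< (natℚ n) ½<1)
  where
  ½<1 : ½ ℚ.< ℚ.1ℚ
  ½<1 = ℚ.*<* (ℤ.+<+ (ℕ.s≤s (ℕ.s≤s ℕ.z≤n)))

sum⁺-nat : ∀ {A : Set} {f : A → ℝ⁺} {g : A → ℕ} → (∀ a → val (f a) ≐ val (nat⁺ (g a))) →
           ∀ xs → val (sum⁺ (List.map f xs)) ≐ val (nat⁺ (sum (List.map g xs)))
sum⁺-nat         h []       n = refl
sum⁺-nat {g = g} h (a ∷ xs) n = trans
  (cong₂ ℚ._+_ (h a n) (sum⁺-nat h xs n)) (sym (natℚ-+ (g a) _))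

-- Double-negation shift, valid for finite index sets. It allows finitely many undecided statements
-- to be treated as decided while a contradiction is derived.
¬¬-Fin : ∀ {n} {P : Fin n → Set} → (∀ i → ¬ ¬ P i) → ¬ ¬ (∀ i → P i)
¬¬-Fin {zero}  h k = k λ ()
¬¬-Fin {suc n} h k = h zero λ p → ¬¬-Fin (h ∘ suc) λ ps → k λ { zero → p ; (suc i) → ps i }

-- Walks in multi-digraphs

module Walks (Γ : MultiDigraph) where
  open MultiDigraph Γ
  open Paths Γ

  infixr 5 _⊕_

  _⊕_ : ∀ {u v w} → Path u v → Path v w → Path u w
  []             ⊕ q = q
  (e ∷⟨ eq ⟩ p) ⊕ q = e ∷⟨ eq ⟩ (p ⊕ q)

  edges-⊕ : ∀ {u v w} (p : Path u v) (q : Path v w) → edges (p ⊕ q) ≡ edges p ++ edges q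
  edges-⊕ []             q = refl
  edges-⊕ (e ∷⟨ _ ⟩ p) q = cong (e ∷_) (edges-⊕ p q)

  first∈ : ∀ {u v} (p : Path u v) → u ∈ nodes p
  first∈ []            = here refl
  first∈ (e ∷⟨ _ ⟩ p) = here refl

  last∈ : ∀ {u v} (p : Path u v) → v ∈ nodes p
  last∈ []            = here refl
  last∈ (e ∷⟨ _ ⟩ p) = there (last∈ p)

  ∈-⊕⁻ : ∀ {u v w x} (p : Path u v) (q : Path v w) →
         x ∈ nodes (p ⊕ q) → x ∈ nodes p ⊎ x ∈ nodes q
  ∈-⊕⁻ []            q x∈          = inj₂ x∈
  ∈-⊕⁻ (e ∷⟨ _ ⟩ p) q (here refl) = inj₁ (here refl)
  ∈-⊕⁻ (e ∷⟨ _ ⟩ p) q (there x∈)  = Sum.map₁ there (∈-⊕⁻ p q x∈)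

  src∈ : ∀ {u v e} (p : Path u v) → e ∈ edges p → src e ∈ nodes p
  src∈ (e ∷⟨ eq ⟩ p) (here refl) = here eq
  src∈ (_ ∷⟨ _ ⟩ p)  (there e∈)  = there (src∈ p e∈)

  tgt∈ : ∀ {u v e} (p : Path u v) → e ∈ edges p → tgt e ∈ nodes p
  tgt∈ (e ∷⟨ _ ⟩ p) (here refl) = there (first∈ p)
  tgt∈ (_ ∷⟨ _ ⟩ p) (there e∈)  = there (tgt∈ p e∈)

  tgt≢first : ∀ {u v e} (p : Path u v) → Simple p → e ∈ edges p → tgt e ≢ u
  tgt≢first (e ∷⟨ _ ⟩ p) (u∉ ∷ _) (here refl) eq = All.lookup u∉ (first∈ p) (sym eq)
  tgt≢first (_ ∷⟨ _ ⟩ p) (u∉ ∷ _) (there e∈)  eq = All.lookup u∉ (tgt∈ p e∈) (sym eq)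

  simple-⊕ : ∀ {u v w} (p : Path u v) (q : Path v w) → Simple p → Simple q →
             (∀ {x} → x ∈ nodes p → x ∈ nodes q → x ≡ v) → Simple (p ⊕ q)
  simple-⊕ []            q _         sq meet = sq
  simple-⊕ (e ∷⟨ _ ⟩ p) q (u∉ ∷ sp) sq meet =
    All.tabulate (λ x∈ eq → apart (∈-⊕⁻ p q x∈) eq) ∷ simple-⊕ p q sp sq (meet ∘ there)
    where
    apart : ∀ {x} → x ∈ nodes p ⊎ x ∈ nodes q → _ ≢ x
    apart (inj₁ x∈p) eq   = All.lookup u∉ x∈p eq
    apart (inj₂ x∈q) refl = All.lookup u∉ (last∈ p) (meet (here refl) x∈q)

  open UIP.Decidable⇒UIP (Fin._≟_ {#nodes}) using (≡-irrelevant)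

  -- The node equations stored in a path are unique because equality of nodes is decidable. Equality
  -- of paths is thus decided on their edge lists.
  edges-injective : ∀ {u v} (p q : Path u v) → edges p ≡ edges q → p ≡ q
  edges-injective []             []               _  = refl
  edges-injective (e ∷⟨ eq ⟩ p) (f ∷⟨ eq′ ⟩ q) h
    with refl ← ∷-injectiveˡ h
    with refl ← edges-injective p q (∷-injectiveʳ h) = cong (e ∷⟨_⟩ p) (≡-irrelevant eq eq′)

  simplePath-≡ : ∀ {u v} {p q : SimplePath u v} → path p ≡ path q → p ≡ q
  simplePath-≡ refl = refl

  _≟ˢ_ : ∀ {u v} (p q : SimplePath u v) → Dec (p ≡ q)
  p ≟ˢ q = map′ (λ eq → simplePath-≡ (edges-injective (path p) (path q) eq))
    (cong (edges ∘ path)) (≡-dec Fin._≟_ (edges (path p)) (edges (path q)))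

  suffix : ∀ {u v w} (p : Path u v) → w ∈ nodes p →
           Σ (Path w v) λ q → nodes q ⊆ nodes p × (Simple p → Simple q)
  suffix p@[]            (here refl) = p , id , id
  suffix p@(_ ∷⟨ _ ⟩ _) (here refl) = p , id , id
  suffix (e ∷⟨ _ ⟩ p)   (there w∈)  with q , q⊆p , sq ← suffix p w∈ =
    q , there ∘ q⊆p , λ { (_ ∷ sp) → sq sp }

  prefix : ∀ {u v w} (p : Path u v) → w ∈ nodes p →
           Σ (Path u w) λ q → edges q ⊆ edges p
  prefix []             (here refl) = [] , id
  prefix (_ ∷⟨ _ ⟩ _)  (here refl) = [] , λ ()
  prefix (e ∷⟨ eq ⟩ p) (there w∈) with q , q⊆p ← prefix p w∈ =
    e ∷⟨ eq ⟩ q , λ { (here refl) → here refl ; (there f∈) → there (q⊆p f∈) }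

  open DecMembership (Fin._≟_ {#nodes}) using (_∈?_)

  -- Loop erasure from the end: if the first node recurs on the shortened rest, only the part from
  -- that recurrence on is kept.
  shorten : ∀ {u v} (p : Path u v) → Σ (SimplePath u v) λ q → nodes (path q) ⊆ nodes p
  shorten []                  = mkSimple [] ([] ∷ []) , id
  shorten {u} (e ∷⟨ eq ⟩ p) with q , q⊆p ← shorten p with u ∈? nodes (path q)
  ... | yes u∈q = let q′ , q′⊆q , simple = suffix (path q) u∈q in
    mkSimple q′ (simple (simple! q)) , there ∘ q⊆p ∘ q′⊆q
  ... | no u∉q  = mkSimple (e ∷⟨ eq ⟩ path q)
    (All.tabulate (λ { x∈ refl → u∉q x∈ }) ∷ simple! q) ,
    λ { (here refl) → here refl ; (there x∈) → there (q⊆p x∈) }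

  splitAtEdge : ∀ {u v e} (p : Path u v) → e ∈ edges p →
                Σ (Path u (src e)) λ p₁ → Σ (Path (tgt e) v) λ p₂ →
                edges p ≡ edges p₁ ++ e ∷ edges p₂
  splitAtEdge (e ∷⟨ refl ⟩ p) (here refl) = [] , p , refl
  splitAtEdge (f ∷⟨ eq ⟩ p)   (there e∈) with p₁ , p₂ , eqs ← splitAtEdge p e∈ =
    f ∷⟨ eq ⟩ p₁ , p₂ , cong (f ∷_) eqs

  -- Visits of a walk to a set of nodes.

  module _ {B : Node → Set} (B? : ∀ x → Dec (B x)) where

    firstHit : ∀ {u z} (p : Path u z) → B z →
               ∃ λ j → Σ (Path u j) λ p₁ → Σ (Path j z) λ p₂ →
               B j × (∀ {x} → x ∈ nodes p₁ → B x → x ≡ j) ×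
               nodes p₁ ⊆ nodes p × nodes p₂ ⊆ nodes p
    firstHit {u} [] Bz = u , [] , [] , Bz , (λ { (here refl) _ → refl }) , id , id
    firstHit {u} p@(e ∷⟨ eq ⟩ p′) Bz with B? u
    ... | yes Bu = u , [] , p , Bu , (λ { (here refl) _ → refl }) ,
      (λ { (here refl) → here refl }) , id
    ... | no ¬Bu with j , p₁ , p₂ , Bj , only , p₁⊆ , p₂⊆ ← firstHit p′ Bz =
      j , e ∷⟨ eq ⟩ p₁ , p₂ , Bj ,
      (λ { (here refl) Bx → contradiction Bx ¬Bu ; (there x∈) Bx → only x∈ Bx }) ,
      (λ { (here refl) → here refl ; (there x∈) → there (p₁⊆ x∈) }) , there ∘ p₂⊆

    lastVisit : ∀ {u z} (p : Path u z) → Any B (nodes p) →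
                ∃ λ i → Σ (Path u i) λ p₁ → Σ (Path i z) λ p₂ →
                B i × (∀ {x} → x ∈ nodes p₂ → B x → x ≡ i) ×
                nodes p₁ ⊆ nodes p × nodes p₂ ⊆ nodes p
    lastVisit {u} [] (here Bu) = u , [] , [] , Bu , (λ { (here refl) _ → refl }) , id , id
    lastVisit {u} p@(e ∷⟨ eq ⟩ p′) some with Any.any? B? (nodes p′)
    ... | yes some′ with i , p₁ , p₂ , Bi , only , p₁⊆ , p₂⊆ ← lastVisit p′ some′ =
      i , e ∷⟨ eq ⟩ p₁ , p₂ , Bi , only ,
      (λ { (here refl) → here refl ; (there x∈) → there (p₁⊆ x∈) }) , there ∘ p₂⊆
    lastVisit {u} p@(e ∷⟨ eq ⟩ p′) (there some) | no none = contradiction some none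
    lastVisit {u} p@(e ∷⟨ eq ⟩ p′) (here Bu)    | no none = u , [] , p , Bu ,
      (λ { (here refl) _ → refl
         ; (there x∈) Bx → contradiction (Any.map (λ { refl → Bx }) x∈) none }) ,
      (λ { (here refl) → here refl }) , id

  -- When A and B partition the nodes of a path, the jump is an ear of that path: its interior
  -- avoids the path.
  record Jump (A B : Node → Set) {u z} (p : Path u z) : Set where
    field
      {from to} : Node
      before    : Path u from
      jump      : Path from to
      after     : Path to z
      from∈A    : A from
      to∈B      : B to
      only-from : ∀ {x} → x ∈ nodes jump → A x → x ≡ from
      only-to   : ∀ {x} → x ∈ nodes jump → B x → x ≡ to
      before⊆   : nodes before ⊆ nodes p
      jump⊆     : nodes jump ⊆ nodes p
      after⊆    : nodes after ⊆ nodes p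

  -- Stop at the first node in B, then go back to the last node in A before it; the stretch between
  -- them has no other node in either set.
  findJump : ∀ {A B : Node → Set} → (∀ x → Dec (A x)) → (∀ x → Dec (B x)) →
             ∀ {u z} (p : Path u z) → A u → B z → Jump A B p
  findJump A? B? {u} p Au Bz
    with j , p₁ , p₂ , Bj , only-to , p₁⊆ , p₂⊆ ← firstHit B? p Bz
    with i , q₁ , q₂ , Ai , only-from , q₁⊆ , q₂⊆
      ← lastVisit A? p₁ (Any.map (λ { refl → Au }) (first∈ p₁))
    = record
    { before    = q₁
    ; jump      = q₂
    ; after     = p₂
    ; from∈A    = Ai
    ; to∈B      = Bj
    ; only-from = only-from
    ; only-to   = only-to ∘ q₂⊆
    ; before⊆   = p₁⊆ ∘ q₁⊆
    ; jump⊆     = p₁⊆ ∘ q₂⊆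
    ; after⊆    = p₂⊆
    }

  -- Positions of nodes along a path.

  rank : List Node → Node → ℕ
  -- As a result a node off the list gets the length of the list as its rank, so rank comparisons
  -- are paired with membership.
  rank []       x = 0
  rank (y ∷ ys) x with x Fin.≟ y
  ... | yes _ = 0
  ... | no _  = suc (rank ys x)

  rank-here : ∀ y ys → rank (y ∷ ys) y ≡ 0
  rank-here y ys with y Fin.≟ y
  ... | yes _  = refl
  ... | no y≢y = contradiction refl y≢y

  rank-first : ∀ {u v} (p : Path u v) → rank (nodes p) u ≡ 0
  rank-first []            = rank-here _ []
  rank-first (e ∷⟨ _ ⟩ p) = rank-here _ (nodes p)

  rank-there : ∀ {x y} ys → x ≢ y → rank (y ∷ ys) x ≡ suc (rank ys x)
  rank-there {x} {y} ys x≢y with x Fin.≟ y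
  ... | yes x≡y = contradiction x≡y x≢y
  ... | no _    = refl

  rank-injective : ∀ {x y} ys → x ∈ ys → y ∈ ys → rank ys x ≡ rank ys y → x ≡ y
  rank-injective {x} {y} (z ∷ ys) x∈ y∈ eq with x Fin.≟ z | y Fin.≟ z
  ... | yes refl | yes refl = refl
  ... | no x≢z   | no y≢z   =
    rank-injective ys (Any.tail x≢z x∈) (Any.tail y≢z y∈) (ℕ.suc-injective eq)

  rank-last : ∀ {u v x} (p : Path u v) → Simple p → x ∈ nodes p →
              rank (nodes p) x ℕ.≤ rank (nodes p) v
  rank-last {u} [] sp (here refl) = ℕ.≤-refl
  rank-last {u} {v} {x} (e ∷⟨ _ ⟩ p) (u∉ ∷ sp) x∈ with x Fin.≟ u
  ... | yes _  = ℕ.z≤n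
  ... | no x≢u with v Fin.≟ u
  ...   | yes refl = contradiction refl (All.lookup u∉ (last∈ p))
  ...   | no _     = ℕ.s≤s (rank-last p sp (Any.tail x≢u x∈))

  -- Stopping at the first visit to y bounds the ranks even if p repeats nodes.
  prefixTo : ∀ {u v y} (p : Path u v) → y ∈ nodes p → Σ (Path u y) λ q →
             ∀ {x} → x ∈ nodes q → x ∈ nodes p × rank (nodes p) x ℕ.≤ rank (nodes p) y
  prefixTo {u} {y = y} p y∈ with y Fin.≟ u
  prefixTo p y∈ | yes refl = [] , λ { (here refl) → first∈ p , ℕ.≤-refl }
  prefixTo []             (here refl) | no y≢u = contradiction refl y≢u
  prefixTo {u} {y = y} (e ∷⟨ eq ⟩ p) y∈ | no y≢u
    with q , bound ← prefixTo p (Any.tail y≢u y∈) = e ∷⟨ eq ⟩ q , bound′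
    where
    bound′ : ∀ {x} → x ∈ u ∷ nodes q →
             x ∈ u ∷ nodes p × rank (u ∷ nodes p) x ℕ.≤ rank (u ∷ nodes p) y
    bound′ (here refl) = here refl ,
      subst (ℕ._≤ rank (u ∷ nodes p) y) (sym (rank-here u (nodes p))) ℕ.z≤n
    bound′ {x} (there x∈) with x Fin.≟ u
    ... | yes refl = here refl , ℕ.z≤n
    ... | no _     = there (bound x∈ .proj₁) ,
      subst (suc (rank (nodes p) x) ℕ.≤_) (sym (rank-there (nodes p) y≢u)) (ℕ.s≤s (bound x∈ .proj₂))

  -- Nodes before x are dropped one at a time, then `prefixTo` cuts at y. By simplicity a dropped
  -- node does not recur, so each drop lowers all remaining ranks by exactly one.
  segment : ∀ {u v x y} (p : Path u v) → Simple p → x ∈ nodes p → y ∈ nodes p →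
            rank (nodes p) x ℕ.≤ rank (nodes p) y → Σ (Path x y) λ q →
            ∀ {w} → w ∈ nodes q → w ∈ nodes p ×
              rank (nodes p) x ℕ.≤ rank (nodes p) w × rank (nodes p) w ℕ.≤ rank (nodes p) y
  segment []                          sp        (here refl) (here refl) le =
    [] , λ { (here refl) → here refl , ℕ.≤-refl , ℕ.≤-refl }
  segment {u} {v} {x} {y} (e ∷⟨ eq ⟩ p) (u∉ ∷ sp) x∈ y∈ le = go (x Fin.≟ u) (y Fin.≟ u)
    where
    r r′ : Node → ℕ
    r  = rank (u ∷ nodes p)
    r′ = rank (nodes p)

    go : Dec (x ≡ u) → Dec (y ≡ u) → Σ (Path x y) λ q →
         ∀ {w} → w ∈ nodes q → w ∈ u ∷ nodes p × r x ℕ.≤ r w × r w ℕ.≤ r y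
    go (yes refl) _ with q , bound ← prefixTo (e ∷⟨ eq ⟩ p) y∈ = q , λ {w} w∈ →
      bound w∈ .proj₁ , subst (ℕ._≤ r w) (sym (rank-here u (nodes p))) ℕ.z≤n , bound w∈ .proj₂
    go (no x≢u) (yes refl) = contradiction
      (subst₂ ℕ._≤_ (rank-there (nodes p) x≢u) (rank-here u (nodes p)) le) λ ()
    go (no x≢u) (no y≢u)
      with q , bound ← segment p sp (Any.tail x≢u x∈) (Any.tail y≢u y∈)
             (ℕ.s≤s⁻¹ (subst₂ ℕ._≤_ (rank-there (nodes p) x≢u) (rank-there (nodes p) y≢u) le)) =
      q , λ {w} w∈ →
        let w∈p , x≤w , w≤y = bound w∈
            w≢u = λ (w≡u : w ≡ u) → All.lookup u∉ w∈p (sym w≡u)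
        in there w∈p ,
           subst₂ ℕ._≤_ (sym (rank-there (nodes p) x≢u)) (sym (rank-there (nodes p) w≢u)) (ℕ.s≤s x≤w) ,
           subst₂ ℕ._≤_ (sym (rank-there (nodes p) w≢u)) (sym (rank-there (nodes p) y≢u)) (ℕ.s≤s w≤y)

-- Crossed paths contain the Wheatstone graph

private
  pattern A = zero
  pattern B = suc zero
  pattern C = suc (suc zero)
  pattern D = suc (suc (suc zero))
  pattern AB = zero
  pattern AC = suc zero
  pattern BC = suc (suc zero)
  pattern BD = suc (suc (suc zero))
  pattern CD = suc (suc (suc (suc zero)))

module Wheatstone where
  open MultiDigraph 𝒲 public
  open Paths 𝒲 public
  open Walks 𝒲 public

-- Decided by running through all pairs of edges. It allows a side to be identified by its two
-- corners.
parallel-free : ∀ e f → Wheatstone.src e ≡ Wheatstone.src f →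
                Wheatstone.tgt e ≡ Wheatstone.tgt f → e ≡ f
parallel-free = from-yes (Fin.all? λ e → Fin.all? λ f →
  (Wheatstone.src e Fin.≟ Wheatstone.src f) →-dec (Wheatstone.tgt e Fin.≟ Wheatstone.tgt f) →-dec
  (e Fin.≟ f))

any∈? : ∀ {A : Set} {P : A → Set} (xs : List A) → (∀ x → x ∈ xs) → (∀ x → Dec (P x)) → Dec (∃ P)
any∈? xs all∈ P? = map′ Any.satisfied
  (λ { (x , Px) → Any.map (λ { refl → Px }) (all∈ x) }) (Any.any? P? xs)

module Crossing (G : Net) where
  open Net G
  open Walks graph
  open DecMembership (Fin._≟_ {#nodes}) using (_∈?_)

  module _ (P : SP) where

    r : Node → ℕ
    r = rank (nodes (path P))

    OnP : Node → Set
    OnP v = v ∈ nodes (path P)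

    Between : Node → Node → Node → Set
    Between x y v = OnP v × r x ℕ.≤ r v × r v ℕ.≤ r y

    between-end : ∀ {x y z v} → OnP y → Between x y v → Between y z v → v ≡ y
    between-end y∈ (v∈ , _ , v≤y) (_ , y≤v , _) =
      rank-injective (nodes (path P)) v∈ y∈ (ℕ.≤-antisym v≤y y≤v)

    between-apart : ∀ {x y x′ y′ v} → r y ℕ.< r x′ → Between x y v → Between x′ y′ v → ⊥
    between-apart y<x′ (_ , _ , v≤y) (_ , x′≤v , _) = ℕ.<⇒≱ y<x′ (ℕ.≤-trans x′≤v v≤y)

    piece : ∀ {x y} → OnP x → OnP y → r x ℕ.≤ r y →
            Σ (SimplePath x y) λ q → ∀ {v} → v ∈ nodes (path q) → Between x y v
    piece x∈ y∈ le with q , bound ← segment (path P) (simple! P) x∈ y∈ le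
      with q′ , q′⊆q ← shorten q = q′ , bound ∘ q′⊆q

    -- Two interleaved ears of a simple path.

    module _ {a b c d : Node} (a∈ : OnP a) (b∈ : OnP b) (c∈ : OnP c) (d∈ : OnP d)
             (a<b : r a ℕ.< r b) (b<c : r b ℕ.< r c) (c<d : r c ℕ.< r d)
             (ear₁ : SimplePath a c) (ear₂ : SimplePath b d)
             (meets₁ : ∀ {v} → v ∈ nodes (path ear₁) → OnP v → v ≡ a ⊎ v ≡ c)
             (meets₂ : ∀ {v} → v ∈ nodes (path ear₂) → OnP v → v ≡ b ⊎ v ≡ d)
             (apart : ∀ {v} → v ∈ nodes (path ear₁) → v ∉ nodes (path ear₂)) where

      private
        a<c = ℕ.<-trans a<b b<c
        b<d = ℕ.<-trans b<c c<d
        a<d = ℕ.<-trans a<c c<d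

        s-a = piece (first∈ (path P)) a∈
          (subst (ℕ._≤ r a) (sym (rank-first (path P))) ℕ.z≤n)
        a-b = piece a∈ b∈ (ℕ.<⇒≤ a<b)
        b-c = piece b∈ c∈ (ℕ.<⇒≤ b<c)
        c-d = piece c∈ d∈ (ℕ.<⇒≤ c<d)
        d-t = piece d∈ (last∈ (path P)) (rank-last (path P) (simple! P) d∈)

        corner : MultiDigraph.Node 𝒲 → Node
        corner A = a
        corner B = b
        corner C = c
        corner D = d

        corner-injective : Injective _≡_ _≡_ corner
        corner-injective {A} {A} _  = refl
        corner-injective {B} {B} _  = refl
        corner-injective {C} {C} _  = refl
        corner-injective {D} {D} _  = refl
        corner-injective {A} {B} eq = contradiction (cong r eq) (ℕ.<⇒≢ a<b)
        corner-injective {A} {C} eq = contradiction (cong r eq) (ℕ.<⇒≢ a<c)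
        corner-injective {A} {D} eq = contradiction (cong r eq) (ℕ.<⇒≢ a<d)
        corner-injective {B} {C} eq = contradiction (cong r eq) (ℕ.<⇒≢ b<c)
        corner-injective {B} {D} eq = contradiction (cong r eq) (ℕ.<⇒≢ b<d)
        corner-injective {C} {D} eq = contradiction (cong r eq) (ℕ.<⇒≢ c<d)
        corner-injective {B} {A} eq = contradiction (cong r eq) (ℕ.>⇒≢ a<b)
        corner-injective {C} {A} eq = contradiction (cong r eq) (ℕ.>⇒≢ a<c)
        corner-injective {D} {A} eq = contradiction (cong r eq) (ℕ.>⇒≢ a<d)
        corner-injective {C} {B} eq = contradiction (cong r eq) (ℕ.>⇒≢ b<c)
        corner-injective {D} {B} eq = contradiction (cong r eq) (ℕ.>⇒≢ b<d)
        corner-injective {D} {C} eq = contradiction (cong r eq) (ℕ.>⇒≢ c<d)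

        open MultiDigraph 𝒲 using () renaming (src to srcᵂ; tgt to tgtᵂ; Edge to Edgeᵂ)

        side : (e : Edgeᵂ) → SimplePath (corner (srcᵂ e)) (corner (tgtᵂ e))
        side AB = a-b .proj₁
        side AC = ear₁
        side BC = b-c .proj₁
        side BD = ear₂
        side CD = c-d .proj₁

        -- An ear touches P only at its two ends. The rank bounds are carried over to the end in
        -- question, so that each use can discard the end outside the stretch.
        ear₁-stretch : ∀ {x y v} → v ∈ nodes (path ear₁) → Between x y v →
                       (v ≡ a × r x ℕ.≤ r a × r a ℕ.≤ r y) ⊎ (v ≡ c × r x ℕ.≤ r c × r c ℕ.≤ r y)
        ear₁-stretch v∈ (v∈P , le) with meets₁ v∈ v∈P
        ... | inj₁ refl = inj₁ (refl , le)
        ... | inj₂ refl = inj₂ (refl , le)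

        ear₂-stretch : ∀ {x y v} → v ∈ nodes (path ear₂) → Between x y v →
                       (v ≡ b × r x ℕ.≤ r b × r b ℕ.≤ r y) ⊎ (v ≡ d × r x ℕ.≤ r d × r d ℕ.≤ r y)
        ear₂-stretch v∈ (v∈P , le) with meets₂ v∈ v∈P
        ... | inj₁ refl = inj₁ (refl , le)
        ... | inj₂ refl = inj₂ (refl , le)

        Shared : Edgeᵂ → Edgeᵂ → Node → Set
        Shared e f v = ∃ λ x → v ≡ corner x × x EndpointOf e × x EndpointOf f

        swap-shared : ∀ {e f v} → Shared e f v → Shared f e v
        swap-shared (x , eq , x-e , x-f) = x , eq , x-f , x-e

        Meet : Edgeᵂ → Edgeᵂ → Set
        Meet e f = ∀ {v} → v ∈ nodes (path (side e)) → v ∈ nodes (path (side f)) → Shared e f v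

        ab-ac : Meet AB AC
        ab-ac v∈ v∈′ with ear₁-stretch v∈′ (a-b .proj₂ v∈)
        ... | inj₁ (v≡a , _)      = A , v≡a , inj₁ refl , inj₁ refl
        ... | inj₂ (_ , _ , c≤b) = contradiction c≤b (ℕ.<⇒≱ b<c)

        ab-bc : Meet AB BC
        ab-bc v∈ v∈′ = B , between-end b∈ (a-b .proj₂ v∈) (b-c .proj₂ v∈′) , inj₂ refl , inj₁ refl

        ab-bd : Meet AB BD
        ab-bd v∈ v∈′ with ear₂-stretch v∈′ (a-b .proj₂ v∈)
        ... | inj₁ (v≡b , _)      = B , v≡b , inj₂ refl , inj₁ refl
        ... | inj₂ (_ , _ , d≤b) = contradiction d≤b (ℕ.<⇒≱ b<d)

        ab-cd : Meet AB CD
        ab-cd v∈ v∈′ = ⊥-elim (between-apart b<c (a-b .proj₂ v∈) (c-d .proj₂ v∈′))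

        ac-bc : Meet AC BC
        ac-bc v∈ v∈′ with ear₁-stretch v∈ (b-c .proj₂ v∈′)
        ... | inj₁ (_ , b≤a , _) = contradiction b≤a (ℕ.<⇒≱ a<b)
        ... | inj₂ (v≡c , _)      = C , v≡c , inj₂ refl , inj₂ refl

        ac-bd : Meet AC BD
        ac-bd v∈ v∈′ = contradiction v∈′ (apart v∈)

        ac-cd : Meet AC CD
        ac-cd v∈ v∈′ with ear₁-stretch v∈ (c-d .proj₂ v∈′)
        ... | inj₁ (_ , c≤a , _) = contradiction c≤a (ℕ.<⇒≱ a<c)
        ... | inj₂ (v≡c , _)      = C , v≡c , inj₂ refl , inj₁ refl

        bc-bd : Meet BC BD
        bc-bd v∈ v∈′ with ear₂-stretch v∈′ (b-c .proj₂ v∈)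
        ... | inj₁ (v≡b , _)      = B , v≡b , inj₁ refl , inj₁ refl
        ... | inj₂ (_ , _ , d≤c) = contradiction d≤c (ℕ.<⇒≱ c<d)

        bc-cd : Meet BC CD
        bc-cd v∈ v∈′ = C , between-end c∈ (b-c .proj₂ v∈) (c-d .proj₂ v∈′) , inj₂ refl , inj₁ refl

        bd-cd : Meet BD CD
        bd-cd v∈ v∈′ with ear₂-stretch v∈ (c-d .proj₂ v∈′)
        ... | inj₁ (_ , c≤b , _) = contradiction c≤b (ℕ.<⇒≱ b<c)
        ... | inj₂ (v≡d , _)      = D , v≡d , inj₂ refl , inj₂ refl

        sides-meet : ∀ e f → e ≢ f → Meet e f
        sides-meet AB AC _ = ab-ac
        sides-meet AB BC _ = ab-bc
        sides-meet AB BD _ = ab-bd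
        sides-meet AB CD _ = ab-cd
        sides-meet AC BC _ = ac-bc
        sides-meet AC BD _ = ac-bd
        sides-meet AC CD _ = ac-cd
        sides-meet BC BD _ = bc-bd
        sides-meet BC CD _ = bc-cd
        sides-meet BD CD _ = bd-cd
        sides-meet AC AB _ = λ v∈ v∈′ → swap-shared {AB} {AC} (ab-ac v∈′ v∈)
        sides-meet BC AB _ = λ v∈ v∈′ → swap-shared {AB} {BC} (ab-bc v∈′ v∈)
        sides-meet BD AB _ = λ v∈ v∈′ → swap-shared {AB} {BD} (ab-bd v∈′ v∈)
        sides-meet CD AB _ = λ v∈ v∈′ → swap-shared {AB} {CD} (ab-cd v∈′ v∈)
        sides-meet BC AC _ = λ v∈ v∈′ → swap-shared {AC} {BC} (ac-bc v∈′ v∈)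
        sides-meet BD AC _ = λ v∈ v∈′ → swap-shared {AC} {BD} (ac-bd v∈′ v∈)
        sides-meet CD AC _ = λ v∈ v∈′ → swap-shared {AC} {CD} (ac-cd v∈′ v∈)
        sides-meet BD BC _ = λ v∈ v∈′ → swap-shared {BC} {BD} (bc-bd v∈′ v∈)
        sides-meet CD BC _ = λ v∈ v∈′ → swap-shared {BC} {CD} (bc-cd v∈′ v∈)
        sides-meet CD BD _ = λ v∈ v∈′ → swap-shared {BD} {CD} (bd-cd v∈′ v∈)
        sides-meet AB AB e≢e = contradiction refl e≢e
        sides-meet AC AC e≢e = contradiction refl e≢e
        sides-meet BC BC e≢e = contradiction refl e≢e
        sides-meet BD BD e≢e = contradiction refl e≢e
        sides-meet CD CD e≢e = contradiction refl e≢e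

        head-meet : ∀ e v → v ∈ nodes (path (s-a .proj₁)) → v ∈ nodes (path (side e)) → v ≡ a
        head-meet AB v v∈ v∈′ = between-end a∈ (s-a .proj₂ v∈) (a-b .proj₂ v∈′)
        head-meet AC v v∈ v∈′ with ear₁-stretch v∈′ (s-a .proj₂ v∈)
        ... | inj₁ (v≡a , _)      = v≡a
        ... | inj₂ (_ , _ , c≤a) = contradiction c≤a (ℕ.<⇒≱ a<c)
        head-meet BC v v∈ v∈′ = ⊥-elim (between-apart a<b (s-a .proj₂ v∈) (b-c .proj₂ v∈′))
        head-meet BD v v∈ v∈′ with ear₂-stretch v∈′ (s-a .proj₂ v∈)
        ... | inj₁ (_ , _ , b≤a) = contradiction b≤a (ℕ.<⇒≱ a<b)
        ... | inj₂ (_ , _ , d≤a) = contradiction d≤a (ℕ.<⇒≱ a<d)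
        head-meet CD v v∈ v∈′ = ⊥-elim (between-apart a<c (s-a .proj₂ v∈) (c-d .proj₂ v∈′))

        tail-meet : ∀ e v → v ∈ nodes (path (d-t .proj₁)) → v ∈ nodes (path (side e)) → v ≡ d
        tail-meet AB v v∈ v∈′ = ⊥-elim (between-apart b<d (a-b .proj₂ v∈′) (d-t .proj₂ v∈))
        tail-meet AC v v∈ v∈′ with ear₁-stretch v∈′ (d-t .proj₂ v∈)
        ... | inj₁ (_ , d≤a , _) = contradiction d≤a (ℕ.<⇒≱ a<d)
        ... | inj₂ (_ , d≤c , _) = contradiction d≤c (ℕ.<⇒≱ c<d)
        tail-meet BC v v∈ v∈′ = ⊥-elim (between-apart c<d (b-c .proj₂ v∈′) (d-t .proj₂ v∈))
        tail-meet BD v v∈ v∈′ with ear₂-stretch v∈′ (d-t .proj₂ v∈)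
        ... | inj₁ (_ , d≤b , _) = contradiction d≤b (ℕ.<⇒≱ b<d)
        ... | inj₂ (v≡d , _)      = v≡d
        tail-meet CD v v∈ v∈′ = between-end d∈ (c-d .proj₂ v∈′) (d-t .proj₂ v∈)

        ends-injective : ∀ {e f} → corner (srcᵂ e) ≡ corner (srcᵂ f) →
                         corner (tgtᵂ e) ≡ corner (tgtᵂ f) → e ≡ f
        ends-injective p q = parallel-free _ _ (corner-injective p) (corner-injective q)

      -- P itself provides head, AB, BC, CD and tail as its stretches between consecutive corners,
      -- and the ears provide AC and BD. Ranks keep the stretches apart.
      interleaved-ears⇒embedding : STEmbedding G
      interleaved-ears⇒embedding = record
        { ϕ             = corner
        ; ϕ-injective   = corner-injective
        ; ψ             = side
        ; ψ-injective   = λ eq → ends-injective (cong proj₁ eq) (cong (proj₁ ∘ proj₂) eq)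
        ; ψ-disjoint    = λ e f e≢f v → sides-meet e f e≢f
        ; head          = s-a .proj₁
        ; tail          = d-t .proj₁
        ; head-tail     = λ v v∈ v∈′ → between-apart a<d (s-a .proj₂ v∈) (d-t .proj₂ v∈′)
        ; head-disjoint = head-meet
        ; tail-disjoint = tail-meet
        }

    CrossingEmbeds : Node → Node → Set
    CrossingEmbeds w z = OnP w → OnP z → r w ℕ.< r z →
      (Q : Path s z) (R : Path w t) → (∀ {v} → v ∈ nodes Q → v ∉ nodes R) → STEmbedding G

    -- From a crossing to interleaved ears.

    module _ {w z : Node} (w∈ : OnP w) (z∈ : OnP z) (w<z : r w ℕ.< r z)
             (Q : Path s z) (R : Path w t) (Q∩R : ∀ {v} → v ∈ nodes Q → v ∉ nodes R)
             (recurse : ∀ {w′ z′} → r z′ ℕ.< r z → CrossingEmbeds w′ z′) where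

      private
        rank≢ : ∀ {x y} → OnP x → OnP y → x ∈ nodes Q → y ∈ nodes R → r x ≢ r y
        rank≢ x∈ y∈ x∈Q y∈R eq with refl ← rank-injective (nodes (path P)) x∈ y∈ eq = Q∩R x∈Q y∈R

        -- Equality is impossible because `s` is on Q and w is on R.
        s<w : r s ℕ.< r w
        s<w = ℕ.≤∧≢⇒< (subst (ℕ._≤ r w) (sym (rank-first (path P))) ℕ.z≤n)
          (rank≢ (first∈ (path P)) w∈ (first∈ Q) (first∈ R))

        -- P is split at w. As Q leads from `s` below w to z above it, a jump of Q is an ear of P
        -- that passes over w.
        Below Above : Node → Set
        Below v = OnP v × r v ℕ.< r w
        Above v = OnP v × ¬ r v ℕ.< r w

        module _ (I : Jump Below Above Q) where

          private
            module I = Jump I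

            -- The open interval spanned by the ear of Q. It contains w but not `t`, so R has a jump
            -- out of it.
            Within Inside Outside : Node → Set
            Within v  = r I.from ℕ.< r v × r v ℕ.< r I.to
            Inside v  = OnP v × Within v
            Outside v = OnP v × ¬ Within v

            within? : ∀ v → Dec (Within v)
            within? v = (r I.from ℕ.<? r v) ×-dec (r v ℕ.<? r I.to)

            w<I : r w ℕ.< r I.to
            w<I = ℕ.≤∧≢⇒< (ℕ.≮⇒≥ (I.to∈B .proj₂))
              (rank≢ (I.to∈B .proj₁) w∈ (I.jump⊆ (last∈ I.jump)) (first∈ R) ∘ sym)

            module _ (J : Jump Inside Outside R) where

              private
                module J = Jump J

                ear₁ = shorten I.jump
                ear₂ = shorten J.jump

                meets₁ : ∀ {v} → v ∈ nodes (path (ear₁ .proj₁)) → OnP v → v ≡ I.from ⊎ v ≡ I.to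
                meets₁ {v} v∈ v∈P with r v ℕ.<? r w
                ... | yes v<w = inj₁ (I.only-from (ear₁ .proj₂ v∈) (v∈P , v<w))
                ... | no v≮w  = inj₂ (I.only-to (ear₁ .proj₂ v∈) (v∈P , v≮w))

                meets₂ : ∀ {v} → v ∈ nodes (path (ear₂ .proj₁)) → OnP v → v ≡ J.from ⊎ v ≡ J.to
                meets₂ {v} v∈ v∈P with within? v
                ... | yes in′ = inj₁ (J.only-from (ear₂ .proj₂ v∈) (v∈P , in′))
                ... | no out  = inj₂ (J.only-to (ear₂ .proj₂ v∈) (v∈P , out))

                -- The landing node is outside the interval, hence at or before `I.from`;
                -- disjointness of Q and R excludes equality.
                J<from : r J.to ℕ.< r I.to → r J.to ℕ.< r I.from
                J<from J<I = ℕ.≤∧≢⇒< (ℕ.≮⇒≥ λ from<J → J.to∈B .proj₂ (from<J , J<I))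
                  (rank≢ (I.from∈A .proj₁) (J.to∈B .proj₁)
                    (I.jump⊆ (first∈ I.jump)) (J.jump⊆ (last∈ J.jump)) ∘ sym)

              -- If R lands beyond `I.to`, the two ears interleave. If it lands before `I.from`, the
              -- part of Q before its jump and the part of R after its jump cross P again, further
              -- back.
              landing : Tri (r I.to ℕ.< r J.to) (r I.to ≡ r J.to) (r J.to ℕ.< r I.to) →
                        STEmbedding G
              landing (tri< I<J _ _) = interleaved-ears⇒embedding
                (I.from∈A .proj₁) (J.from∈A .proj₁) (I.to∈B .proj₁) (J.to∈B .proj₁)
                (J.from∈A .proj₂ .proj₁) (J.from∈A .proj₂ .proj₂) I<J
                (ear₁ .proj₁) (ear₂ .proj₁) meets₁ meets₂
                (λ v∈ v∈′ → Q∩R (I.jump⊆ (ear₁ .proj₂ v∈)) (J.jump⊆ (ear₂ .proj₂ v∈′)))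
              landing (tri≈ _ I≡J _) = contradiction I≡J
                (rank≢ (I.to∈B .proj₁) (J.to∈B .proj₁)
                  (I.jump⊆ (last∈ I.jump)) (J.jump⊆ (last∈ J.jump)))
              -- The new z is `I.from`, which precedes w and therefore the old z.
              landing (tri> _ _ J<I) = recurse (ℕ.<-trans (I.from∈A .proj₂) w<z)
                (J.to∈B .proj₁) (I.from∈A .proj₁) (J<from J<I)
                I.before J.after (λ v∈ v∈′ → Q∩R (I.before⊆ v∈) (J.after⊆ v∈′))

              landed : STEmbedding G
              landed = landing (ℕ.<-cmp (r I.to) (r J.to))

          jumped : STEmbedding G
          jumped = landed (findJump
            (λ v → (v ∈? nodes (path P)) ×-dec within? v)
            (λ v → (v ∈? nodes (path P)) ×-dec ¬? (within? v))
            R (w∈ , I.from∈A .proj₂ , w<I)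
            (last∈ (path P) , λ (_ , t<) → ℕ.<⇒≱ t< (rank-last (path P) (simple! P) (I.to∈B .proj₁))))

      crossing-step : STEmbedding G
      crossing-step = jumped (findJump
        (λ v → (v ∈? nodes (path P)) ×-dec (r v ℕ.<? r w))
        (λ v → (v ∈? nodes (path P)) ×-dec ¬? (r v ℕ.<? r w))
        Q (first∈ (path P) , s<w) (z∈ , ℕ.<⇒≯ w<z))

    -- Induction on a bound for the rank of z, which every step back along P lowers.
    crossing⇒embedding : ∀ n {w z} → r z ℕ.< n → CrossingEmbeds w z
    crossing⇒embedding (suc n) z<n w∈ z∈ w<z Q R Q∩R =
      crossing-step w∈ z∈ w<z Q R Q∩R λ z′<z →
        crossing⇒embedding n (ℕ.<-≤-trans z′<z (ℕ.s≤s⁻¹ z<n))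

  -- Only nodes and simple paths are quantified over. Both are finitely enumerated, which makes the
  -- property decidable.
  Crossed : Set
  Crossed = Σ SP λ P → Σ Node λ w → Σ Node λ z →
    (OnP P w × OnP P z × r P w ℕ.< r P z) ×
    Σ (SimplePath s z) λ Q → Σ (SimplePath w t) λ R → All (_∉ nodes (path R)) (nodes (path Q))

  crossed? : Dec Crossed
  crossed? = any∈? allSP ∈-simplePaths λ P → Fin.any? λ w → Fin.any? λ z →
    ((w ∈? nodes (path P)) ×-dec (z ∈? nodes (path P)) ×-dec (r P w ℕ.<? r P z)) ×-dec
    any∈? (simplePaths s z) ∈-simplePaths λ Q → any∈? (simplePaths w t) ∈-simplePaths λ R →
    All.all? (λ v → ¬? (v ∈? nodes (path R))) (nodes (path Q))

  crossed⇒embedding : Crossed → STEmbedding G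
  crossed⇒embedding (P , w , z , (w∈ , z∈ , w<z) , Q , R , Q∩R) =
    crossing⇒embedding P (suc (r P z)) ℕ.≤-refl w∈ z∈ w<z (path Q) (path R) (All.lookup Q∩R)

-- A Braess paradox yields crossed paths

module SubnetPaths {G : Net} (H : Subnet G) where
  open Subnet H
  private
    module G = Net G
    module H = Net net

  -- The ends are given up to equality because `source`, `target` and the edge conditions of a
  -- subnet are propositional equations.
  lift : ∀ {u v x y} (p : H.Path u v) → node u ≡ x → node v ≡ y → G.Path x y
  lift {u} H.[]           refl refl = G.[]
  lift (e H.∷⟨ eq ⟩ p) x≡ y≡ =
    edge e G.∷⟨ trans (src-edge e) (trans (cong node eq) x≡) ⟩ lift p (sym (tgt-edge e)) y≡

  edges-lift : ∀ {u v x y} (p : H.Path u v) (x≡ : node u ≡ x) (y≡ : node v ≡ y) →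
               G.edges (lift p x≡ y≡) ≡ List.map edge (H.edges p)
  edges-lift H.[]           refl refl = refl
  edges-lift (e H.∷⟨ _ ⟩ p) x≡   y≡   = cong (edge e ∷_) (edges-lift p (sym (tgt-edge e)) y≡)

  nodes-lift : ∀ {u v x y} (p : H.Path u v) (x≡ : node u ≡ x) (y≡ : node v ≡ y) →
               G.nodes (lift p x≡ y≡) ≡ List.map node (H.nodes p)
  nodes-lift H.[]           refl refl = refl
  nodes-lift (e H.∷⟨ _ ⟩ p) x≡   y≡   =
    cong₂ _∷_ (sym x≡) (nodes-lift p (sym (tgt-edge e)) y≡)

  simple-lift : ∀ {u v x y} (p : H.Path u v) (x≡ : node u ≡ x) (y≡ : node v ≡ y) →
                H.Simple p → G.Simple (lift p x≡ y≡)
  simple-lift p x≡ y≡ sp = subst Unique (sym (nodes-lift p x≡ y≡)) (Unique.map⁺ node-injective sp)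

  liftSP : H.SP → G.SP
  liftSP p = G.mkSimple (lift (H.path p) source target)
    (simple-lift (H.path p) source target (H.simple! p))

-- Shortest walks with respect to a Wardrop flow.

module Wardrop (G : Net) (l : Latency G) (φ : Flow G)
  (optimal : ∀ p q → 0⁺ <⁺ φ p → pathLatency G l φ (Net.path {G} p) ≤⁺ pathLatency G l φ q) where
  open Net G
  open Walks graph

  cost : Edge → ℝ⁺
  cost e = Latency.fun l e (edgeFlow G φ e)

  Carries : Edge → Set
  Carries e = ∃ λ p → 0ℝ < val (φ p) × e ∈ edges (path p)

  -- If e lies on the used path p₁ e p₂, then p₁ followed by p is a competitor
  -- of that path, so e p₂ is no longer than p.
  carrying-shortest : ∀ {u} (q p : Path u t) → All Carries (edges q) →
                      Σ⁺ cost (edges q) ≤ Σ⁺ cost (edges p)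
  carrying-shortest []                p _ = nonneg (sum⁺ (List.map cost (edges p)))
  carrying-shortest (e ∷⟨ refl ⟩ q) p ((P , pos , e∈P) ∷ carries) =
    compare (splitAtEdge (path P) e∈P)
    where
    Σc : List Edge → ℝ
    Σc = Σ⁺ cost

    compare : Σ (Path s (src e)) (λ p₁ → Σ (Path (tgt e) t) λ p₂ →
                edges (path P) ≡ edges p₁ ++ e ∷ edges p₂) →
              val (cost e) + Σc (edges q) ≤ Σc (edges p)
    compare (p₁ , p₂ , eq) = ≤-trans (val (cost e) + Σc (edges q)) (Σc (e ∷ edges p₂)) (Σc (edges p))
      (+-mono-≤ (val (cost e)) (val (cost e)) (Σc (edges q)) (Σc (edges p₂))
        (≤-refl (val (cost e))) (carrying-shortest q p₂ carries))
      (+-cancelˡ-≤ (Σc (edges p₁)) (Σc (e ∷ edges p₂)) (Σc (edges p)) detour)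
      where
      detour : Σc (edges p₁) + Σc (e ∷ edges p₂) ≤ Σc (edges p₁) + Σc (edges p)
      detour = ≤-trans (Σc (edges p₁) + Σc (e ∷ edges p₂)) (Σc (edges (p₁ ⊕ p)))
        (Σc (edges p₁) + Σc (edges p))
        (≤-trans (Σc (edges p₁) + Σc (e ∷ edges p₂)) (Σc (edges (path P))) (Σc (edges (p₁ ⊕ p)))
          (≐⇒≤ (Σc (edges p₁) + Σc (e ∷ edges p₂)) (Σc (edges (path P))) λ n →
            sym (trans (cong (λ es → seq (Σc es) n) eq) (sum⁺-++ cost (edges p₁) (e ∷ edges p₂) n)))
          (optimal P (p₁ ⊕ p) pos))
        (≐⇒≤ (Σc (edges (p₁ ⊕ p))) (Σc (edges p₁) + Σc (edges p)) λ n →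
          trans (cong (λ es → seq (Σc es) n) (edges-⊕ p₁ p)) (sum⁺-++ cost (edges p₁) (edges p) n))

-- Comparison of the Wardrop flows of an uncrossed net and a subnet.

module NoParadox (G : Net) (l : Latency G) (H : Subnet G) (r : ℝ⁺) (0<r : 0ℝ < val r)
  (φ : Flow G) (χ : Flow (Subnet.net H))
  (φ-wardrop : IsWardrop G r l φ) (χ-wardrop : IsWardrop (Subnet.net H) r (Subnet.restrict H l) χ)
  (uncrossed : ¬ Crossing.Crossed G) where

  open Subnet H
  open SubnetPaths H
  open Crossing G using (Crossed)
  private
    module G = Net G
    module H = Net net
    module WG = Walks G.graph
    module WH = Walks H.graph
    module φ = Wardrop G l φ (φ-wardrop .proj₂)
    module χ = Wardrop net (restrict l) χ (χ-wardrop .proj₂)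
  open G using (_∷⟨_⟩_)
  open DecMembership (Fin._≟_ {G.#edges}) using () renaming (_∈?_ to _∈ᴱ?_)

  -- Both flows are measured on the edges of `G`, so that they can be compared on one cut. An edge
  -- outside the subnet has `χ-load` zero.
  φ-load χ-load : G.Edge → ℝ⁺
  φ-load = load (λ f p → f ∈ G.edges (G.path p)) (λ f p → f ∈ᴱ? G.edges (G.path p)) φ G.allSP
  χ-load = load (λ f p → f ∈ List.map edge (H.edges (H.path p)))
                (λ f p → f ∈ᴱ? List.map edge (H.edges (H.path p))) χ H.allSP

  χ-load-edge : ∀ e → χ-load (edge e) ≡ edgeFlow net χ e
  χ-load-edge e = cong (λ ps → sum⁺ (List.map χ ps)) (filter-≐ _ _
    ((λ e∈ → let f , f∈ , eq = ∈-map⁻ edge e∈ in subst (_∈ _) (sym (edge-injective eq)) f∈) ,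
     ∈-map⁺ edge) H.allSP)

  Loaded : H.Edge → Set
  Loaded e = χ.Carries e × val (φ-load (edge e)) ≤ val (edgeFlow net χ e)

  -- The sets S and T of the outline, with walks as witnesses: these walks are what forms a
  -- crossing.
  Reached Escapes : G.Node → Set
  Reached v = Σ H.Node λ u → node u ≡ v × Σ (H.Path H.s u) λ q → All Loaded (H.edges q)
  Escapes v = Σ (G.Path v G.t) λ p → ∀ {x} → x ∈ G.nodes p → ¬ Reached x

  escapes⇒unreached : ∀ {v} → Escapes v → ¬ Reached v
  escapes⇒unreached (p , avoids) = avoids (WG.first∈ p)

  reached-step : ∀ e → Loaded e → Reached (G.src (edge e)) → Reached (G.tgt (edge e))
  reached-step e loaded (u , u≡ , q , all-loaded) =
    extend q all-loaded (node-injective (trans u≡ (src-edge e)))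
    where
    extend : ∀ {u} (q : H.Path H.s u) → All Loaded (H.edges q) → u ≡ H.src e → Reached (G.tgt (edge e))
    extend q all-loaded refl = H.tgt e , sym (tgt-edge e) , q WH.⊕ (e H.∷⟨ refl ⟩ H.[]) ,
      subst (All Loaded) (sym (WH.edges-⊕ q (e H.∷⟨ refl ⟩ H.[])))
        (All.++⁺ all-loaded (loaded ∷ []))

  reached-nodes : ∀ {u v} (q : H.Path H.s u) (u≡ : node u ≡ v) → All Loaded (H.edges q) →
                  ∀ {x} → x ∈ G.nodes (lift q source u≡) → Reached x
  reached-nodes q u≡ all-loaded {x} x∈ =
    visited (∈-map⁻ node (subst (x ∈_) (nodes-lift q source u≡) x∈))
    where
    visited : (∃ λ w → w ∈ H.nodes q × x ≡ node w) → Reached x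
    visited (w , w∈ , x≡) = w , sym x≡ , WH.prefix q w∈ .proj₁ ,
      All.anti-mono (WH.prefix q w∈ .proj₂) all-loaded

  -- The loaded walk to z has only reached nodes and the escape from w has none, so together they
  -- would cross P.
  no-return : ∀ (P : G.SP) {w z} → w ∈ G.nodes (G.path P) → z ∈ G.nodes (G.path P) →
              WG.rank (G.nodes (G.path P)) w ℕ.< WG.rank (G.nodes (G.path P)) z →
              Escapes w → ¬ Reached z
  no-return P {w} {z} w∈ z∈ w<z (R , avoids) (u , u≡ , q , all-loaded) =
    uncrossed (P , w , z , (w∈ , z∈ , w<z) , Q .proj₁ , R′ .proj₁ , All.tabulate λ x∈Q x∈R →
      avoids (R′ .proj₂ x∈R) (reached-nodes q u≡ all-loaded (Q .proj₂ x∈Q)))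
    where
    Q  = WG.shorten (lift q source u≡)
    R′ = WG.shorten R

  -- The conclusion of `no-return` in a form recursive in the path and free of ranks, as the
  -- induction in `one-crossing` requires.
  NoReturn : ∀ {u v} → G.Path u v → Set
  NoReturn G.[]           = ⊤
  NoReturn (e ∷⟨ _ ⟩ p) = (Escapes (G.tgt e) → ∀ {z} → z ∈ G.nodes p → ¬ Reached z) × NoReturn p

  simple⇒NoReturn : ∀ {u v} (p : G.Path u v) → G.Simple p →
    (∀ {w z} → w ∈ G.nodes p → z ∈ G.nodes p →
       WG.rank (G.nodes p) w ℕ.< WG.rank (G.nodes p) z → Escapes w → ¬ Reached z) →
    NoReturn p
  simple⇒NoReturn G.[] _ _ = tt
  simple⇒NoReturn {u} (e ∷⟨ _ ⟩ p) (u∉ ∷ sp) back = first , simple⇒NoReturn p sp back′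
    where
    back′ : ∀ {w z} → w ∈ G.nodes p → z ∈ G.nodes p →
            WG.rank (G.nodes p) w ℕ.< WG.rank (G.nodes p) z → Escapes w → ¬ Reached z
    back′ w∈ z∈ lt = back (there w∈) (there z∈) (subst₂ ℕ._<_
      (sym (WG.rank-there (G.nodes p) (λ eq → All.lookup u∉ w∈ (sym eq))))
      (sym (WG.rank-there (G.nodes p) (λ eq → All.lookup u∉ z∈ (sym eq)))) (ℕ.s≤s lt))

    first : Escapes (G.tgt e) → ∀ {z} → z ∈ G.nodes p → ¬ Reached z
    first escapes {z} z∈ = case (z Fin.≟ G.tgt e)
      where
      case : Dec (z ≡ G.tgt e) → ¬ Reached z
      case (yes refl) = escapes⇒unreached escapes
      case (no z≢)    = back′ (WG.first∈ p) z∈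
        (ℕ.≤∧≢⇒< (subst (ℕ._≤ WG.rank (G.nodes p) z) (sym (WG.rank-first p)) ℕ.z≤n)
          (λ eq → z≢ (sym (WG.rank-injective (G.nodes p) (WG.first∈ p) z∈ eq)))) escapes

  Crosses : G.Edge → Set
  Crosses f = ¬ Escapes (G.src f) × Escapes (G.tgt f)

  -- Were both alternatives false, φ would be at most χ on f and some path carrying χ would use f.
  -- Then f would be `Loaded` and lead from a reached source to a reached target, although its
  -- target escapes.
  crossing-light : ∀ f → (Crosses f → Reached (G.src f)) → Crosses f →
                   ¬ ¬ (val (χ-load f) ≤ 0ℝ ⊎ val (χ-load f) < val (φ-load f))
  crossing-light f reached crosses heavy =
    heavy (inj₁ (≮⇒≥ 0ℝ (val (χ-load f)) λ pos → sum⁺-positive χ _ pos λ (p , p∈ , 0<χp) →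
      let e , e∈ , f≡ = ∈-map⁻ edge (∈-filter⁻ _ {xs = H.allSP} p∈ .proj₂)
      in tight e f≡ (p , 0<χp , e∈)))
    where
    φ≤χ : val (φ-load f) ≤ val (χ-load f)
    φ≤χ = ≮⇒≥ (val (χ-load f)) (val (φ-load f)) (heavy ∘ inj₂)

    tight : ∀ e → f ≡ edge e → χ.Carries e → ⊥
    tight e refl carries = escapes⇒unreached (crosses .proj₂)
      (reached-step e (carries , subst (λ x → val (φ-load f) ≤ val x) (χ-load-edge e) φ≤χ)
        (reached crosses))

  -- The loaded walk q links the two latencies. P costs at most the image of q under φ; by
  -- monotonicity that is at most the cost of q under χ; and q is shortest under χ because all its
  -- edges carry χ.
  target-reached : Reached G.t → ∀ (P : G.SP) (p : H.SP) → 0ℝ < val (φ P) →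
    val (pathLatency G l φ (G.path P)) ≤ val (pathLatency net (restrict l) χ (H.path p))
  target-reached (u , u≡ , q , all-loaded) P p 0<φP =
    compare q all-loaded (node-injective (trans u≡ (sym target)))
    where
    CG = Σ⁺ φ.cost
    CH = Σ⁺ χ.cost

    compare : ∀ {u} (q : H.Path H.s u) → All Loaded (H.edges q) → u ≡ H.t →
              CG (G.edges (G.path P)) ≤ CH (H.edges (H.path p))
    compare q all-loaded refl =
      ≤-trans (CG (G.edges (G.path P))) (CG (G.edges q̂)) (CH (H.edges (H.path p)))
        (φ-wardrop .proj₂ P q̂ 0<φP)
        (≤-trans (CG (G.edges q̂)) (CH (H.edges q)) (CH (H.edges (H.path p)))
          (≤-trans (CG (G.edges q̂)) (Σ⁺ (φ.cost ∘ edge) (H.edges q)) (CH (H.edges q))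
            (≐⇒≤ (CG (G.edges q̂)) (Σ⁺ (φ.cost ∘ edge) (H.edges q)) λ n →
              cong (λ xs → seq (val (sum⁺ xs)) n) costs-lift)
            (sum⁺-mono (φ.cost ∘ edge) χ.cost (H.edges q) λ {e} e∈ →
              Latency.nonDecreasing l (edge e) (φ-load (edge e)) (edgeFlow net χ e)
                (All.lookup all-loaded e∈ .proj₂)))
          (χ.carrying-shortest q (H.path p) (All.map proj₁ all-loaded)))
      where
      q̂ : G.Path G.s G.t
      q̂ = lift q source target

      costs-lift : List.map φ.cost (G.edges q̂) ≡ List.map (φ.cost ∘ edge) (H.edges q)
      costs-lift = trans (cong (List.map φ.cost) (edges-lift q source target))
        (sym (map-∘ (H.edges q)))

  -- Counting both flows across the cut.

  module _ (reached? : ∀ v → Dec (Reached v)) (escapes? : ∀ v → Dec (Escapes v))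
           (unreached : ¬ Reached G.t) where

    target-escapes : Escapes G.t
    target-escapes = G.[] , λ { (here refl) → unreached }

    source-stays : ¬ Escapes G.s
    source-stays escapes = escapes⇒unreached escapes (H.s , source , H.[] , [])

    -- With an unreached source, f followed by the escape of its target would be an escape of the
    -- source.
    crosses⇒reached : ∀ f → Crosses f → Reached (G.src f)
    crosses⇒reached f (stays , p , avoids) = decidable-stable (reached? (G.src f)) λ ¬reached →
      stays (f ∷⟨ refl ⟩ p , λ { (here refl) → ¬reached ; (there x∈) → avoids x∈ })

    crosses? : ∀ f → Dec (Crosses f)
    crosses? f = ¬? (escapes? (G.src f)) ×-dec escapes? (G.tgt f)

    cut : List G.Edge
    cut = List.filter crosses? (List.allFin G.#edges)

    cut-unique : Unique cut
    cut-unique = Unique.filter⁺ crosses? (Unique.allFin⁺ G.#edges)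

    CrossesOnce : List G.Edge → Set
    CrossesOnce es = ∃ λ f → f ∈ es × Crosses f × (∀ {g} → g ∈ es → Crosses g → g ≡ f)

    -- The path ends in an escaping node, so some edge enters that set. After the first such edge no
    -- reached node follows, hence the rest of the path is an escape from each of its nodes and none
    -- of its edges crosses.
    one-crossing : ∀ {u} (p : G.Path u G.t) → ¬ Escapes u → NoReturn p → CrossesOnce (G.edges p)
    one-crossing G.[] stays _ = contradiction target-escapes stays
    one-crossing (e ∷⟨ refl ⟩ p) stays (first , noReturn) =
      go (escapes? (G.tgt e)) λ stays′ → one-crossing p stays′ noReturn
      where
      go : Dec (Escapes (G.tgt e)) → (¬ Escapes (G.tgt e) → CrossesOnce (G.edges p)) →
           CrossesOnce (e ∷ G.edges p)
      go (yes escapes) _ = e , here refl , (stays , escapes) , only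
        where
        only : ∀ {g} → g ∈ e ∷ G.edges p → Crosses g → g ≡ e
        only (here refl) _ = refl
        only (there g∈) (g-stays , _) = contradiction
          (WG.suffix p (WG.src∈ p g∈) .proj₁ ,
           λ {x} x∈ → first escapes {x} (WG.suffix p (WG.src∈ p g∈) .proj₂ .proj₁ x∈)) g-stays
      go (no stays′) later = let f , f∈ , crosses , only = later stays′ in
        f , there f∈ , crosses ,
        λ { (here refl) (_ , escapes) → contradiction escapes stays′ ; (there g∈) → only g∈ }

    one-in-cut : ∀ (P : G.SP) → ∃ λ f → f ∈ cut × f ∈ G.edges (G.path P) ×
      (∀ {g} → g ∈ cut → g ∈ G.edges (G.path P) → g ≡ f)
    one-in-cut P = inCut (one-crossing (G.path P) source-stays
      (simple⇒NoReturn (G.path P) (G.simple! P) (no-return P)))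
      where
      inCut : CrossesOnce (G.edges (G.path P)) →
              ∃ λ f → f ∈ cut × f ∈ G.edges (G.path P) ×
                (∀ {g} → g ∈ cut → g ∈ G.edges (G.path P) → g ≡ f)
      inCut (f , f∈ , crosses , only) =
        f , ∈-filter⁺ crosses? (∈-allFin f) crosses , f∈ ,
        λ g∈cut g∈ → only g∈ (∈-filter⁻ crosses? {xs = List.allFin G.#edges} g∈cut .proj₂)

    φ-total : Σ⁺ φ-load cut ≐ val (value G φ)
    φ-total = load-total (λ f p → f ∈ G.edges (G.path p)) (λ f p → f ∈ᴱ? G.edges (G.path p)) φ
      cut cut-unique G.allSP one-in-cut

    -- A simple path of the subnet stays simple in `G`, so its image also meets the cut in exactly
    -- one edge.
    χ-total : Σ⁺ χ-load cut ≐ val (value net χ)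
    χ-total = load-total (λ f p → f ∈ List.map edge (H.edges (H.path p)))
      (λ f p → f ∈ᴱ? List.map edge (H.edges (H.path p))) χ cut cut-unique H.allSP λ p →
      subst (λ es → ∃ λ f → f ∈ cut × f ∈ es × (∀ {g} → g ∈ cut → g ∈ es → g ≡ f))
        (edges-lift (H.path p) source target) (one-in-cut (liftSP p))

    χ-total≥r : val r ≤ Σ⁺ χ-load cut
    χ-total≥r = ≤-trans (val r) (val (value net χ)) (Σ⁺ χ-load cut)
      (≃⇒≥ (val (value net χ)) (val r) (χ-wardrop .proj₁))
      (≐⇒≤ (val (value net χ)) (Σ⁺ χ-load cut) λ n → sym (χ-total n))

    φ-total≤r : Σ⁺ φ-load cut ≤ val r
    φ-total≤r = ≤-trans (Σ⁺ φ-load cut) (val (value G φ)) (val r)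
      (≐⇒≤ (Σ⁺ φ-load cut) (val (value G φ)) φ-total)
      (≃⇒≤ (val (value G φ)) (val r) (φ-wardrop .proj₁))

    -- Both totals over the cut amount to the positive rate r, so that of χ can neither vanish nor
    -- be smaller than that of φ.
    cut-light : ¬ (∀ f → Crosses f → val (χ-load f) ≤ 0ℝ ⊎ val (χ-load f) < val (φ-load f))
    cut-light light = refute (sum⁺-drop χ-load φ-load cut λ {f} f∈ →
      light f (∈-filter⁻ crosses? {xs = List.allFin G.#edges} f∈ .proj₂))
      where
      refute : ¬ (Σ⁺ χ-load cut ≤ 0ℝ ⊎ Σ⁺ χ-load cut < Σ⁺ φ-load cut)
      refute (inj₁ χ≤0) = ≤⇒≯ (Σ⁺ χ-load cut) 0ℝ χ≤0
        (<-≤-trans 0ℝ (val r) (Σ⁺ χ-load cut) 0<r χ-total≥r)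
      refute (inj₂ χ<φ) = ≤⇒≯ (Σ⁺ φ-load cut) (Σ⁺ χ-load cut)
        (≤-trans (Σ⁺ φ-load cut) (val r) (Σ⁺ χ-load cut) φ-total≤r χ-total≥r) χ<φ

    target-unreached⇒⊥ : ⊥
    target-unreached⇒⊥ = ¬¬-Fin
      (λ f → ¬¬-pull (crosses? f) λ crosses → crossing-light f (crosses⇒reached f) crosses) cut-light
      where
      ¬¬-pull : ∀ {A B : Set} → Dec A → (A → ¬ ¬ B) → ¬ ¬ (A → B)
      ¬¬-pull (yes a) h k = h a λ b → k λ _ → b
      ¬¬-pull (no ¬a) h k = k λ a → contradiction a ¬a

  -- The goal is a negation, so membership in either set may be assumed decided at each of the
  -- finitely many nodes.
  target-¬¬reached : ¬ ¬ Reached G.t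
  target-¬¬reached unreached =
    ¬¬-Fin (λ v → ¬¬-excluded-middle) λ reached? →
    ¬¬-Fin (λ v → ¬¬-excluded-middle) λ escapes? →
    target-unreached⇒⊥ reached? escapes? unreached

  no-paradox : ∀ {x y} →
    (∀ P → 0⁺ <⁺ φ P → pathLatency G l φ (G.path P) ≃⁺ x) →
    (∀ p → 0⁺ <⁺ χ p → pathLatency net (restrict l) χ (H.path p) ≃⁺ y) → ¬ y <⁺ x
  no-paradox {x} {y} φ-latency χ-latency y<x = target-¬¬reached λ reached →
    sum⁺-positive φ G.allSP (positive G φ (φ-wardrop .proj₁)) λ (P , _ , 0<φP) →
    sum⁺-positive χ H.allSP (positive net χ (χ-wardrop .proj₁)) λ (p , _ , 0<χp) →
    let CP = val (pathLatency G l φ (G.path P))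
        Cp = val (pathLatency net (restrict l) χ (H.path p))
    in ≤⇒≯ (val x) (val y)
      (≤-trans (val x) CP (val y) (≃⇒≥ CP (val x) (φ-latency P 0<φP))
        (≤-trans CP Cp (val y) (target-reached reached P p 0<φP) (≃⇒≤ Cp (val y) (χ-latency p 0<χp))))
      y<x
    where
    positive : ∀ N (f : Flow N) → value N f ≃⁺ r → 0ℝ < val (value N f)
    positive N f eq = <-≤-trans 0ℝ (val r) (val (value N f)) 0<r (≃⇒≥ (val (value N f)) (val r) eq)

vulnerable⇒embedding : ∀ G → Vulnerable G → STEmbedding G
vulnerable⇒embedding G (r , l , H , _ , x , y , Lx , Ly , y<x) =
  crossed⇒embedding (decidable-stable crossed? (refute Lx Ly))
  where
  open Crossing G using (Crossed; crossed?; crossed⇒embedding)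
  refute : IsL G r l x → IsL (Subnet.net H) r (Subnet.restrict H l) y → ¬ ¬ Crossed
  -- At rate 0 the latency of `G` is 0, which exceeds no non-negative y.
  refute (inj₁ (_ , x≃0)) _ _ = ≤⇒≯ (val x) (val y)
    (≤-trans (val x) 0ℝ (val y) (≃⇒≤ (val x) 0ℝ x≃0) (nonneg y)) y<x
  refute (inj₂ (0<r , _)) (inj₁ (r≃0 , _)) _ = ≤⇒≯ (val r) 0ℝ (≃⇒≤ (val r) 0ℝ r≃0) 0<r
  refute (inj₂ (0<r , φ , φ-wardrop , φ-latency)) (inj₂ (_ , χ , χ-wardrop , χ-latency)) uncrossed =
    NoParadox.no-paradox G l H r 0<r φ χ φ-wardrop χ-wardrop uncrossed {x} {y} φ-latency χ-latency y<x

-- The Wheatstone graph yields a Braess paradox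

indicator : {P : Set} → Dec P → ℕ
indicator (yes _) = 1
indicator (no _)  = 0

indicator-yes : {P : Set} (P? : Dec P) → P → indicator P? ≡ 1
indicator-yes (yes _) _ = refl
indicator-yes (no ¬p) p = contradiction p ¬p

indicator-no : {P : Set} (P? : Dec P) → ¬ P → indicator P? ≡ 0
indicator-no (yes p) ¬p = contradiction p ¬p
indicator-no (no _)  _  = refl

module _ {A : Set} where

  sum-map-+ : ∀ (f g : A → ℕ) xs →
    sum (List.map (λ x → f x ℕ.+ g x) xs) ≡ sum (List.map f xs) ℕ.+ sum (List.map g xs)
  sum-map-+ f g []       = refl
  sum-map-+ f g (x ∷ xs) = trans (cong (f x ℕ.+ g x ℕ.+_) (sum-map-+ f g xs))
    (+-interchange (f x) (g x) (sum (List.map f xs)) (sum (List.map g xs)))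

  module _ (_≟_ : (x y : A) → Dec (x ≡ y)) where

    sum-indicator-∉ : ∀ {x xs} → x ∉ xs → sum (List.map (λ y → indicator (y ≟ x)) xs) ≡ 0
    sum-indicator-∉ {x} {[]}     x∉ = refl
    sum-indicator-∉ {x} {y ∷ xs} x∉ = cong₂ ℕ._+_
      (indicator-no (y ≟ x) λ y≡x → x∉ (here (sym y≡x))) (sum-indicator-∉ (x∉ ∘ there))

    sum-indicator-∈ : ∀ {x xs} → Unique xs → x ∈ xs → sum (List.map (λ y → indicator (y ≟ x)) xs) ≡ 1
    sum-indicator-∈ {x} (x∉ ∷ un) (here refl) = cong₂ ℕ._+_
      (indicator-yes (x ≟ x) refl) (sum-indicator-∉ λ x∈ → All.lookup x∉ x∈ refl)
    sum-indicator-∈ {x} (y∉ ∷ un) (there {y} x∈) = cong₂ ℕ._+_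
      (indicator-no (y ≟ x) (All.lookup y∉ x∈)) (sum-indicator-∈ un x∈)

lookup-injective : ∀ {A : Set} {xs : List A} → Unique xs → Injective _≡_ _≡_ (List.lookup xs)
lookup-injective (_  ∷ _)  {zero}  {zero}  _  = refl
lookup-injective (x∉ ∷ _)  {zero}  {suc j} eq = contradiction eq (All.lookup x∉ (∈-lookup j))
lookup-injective (x∉ ∷ _)  {suc i} {zero}  eq = contradiction (sym eq) (All.lookup x∉ (∈-lookup i))
lookup-injective (_  ∷ un) {suc i} {suc j} eq = cong suc (lookup-injective un eq)

-- Identity and constants suffice for the paradox. Both take natural loads to natural costs, so
-- costs can be computed in `ℕ`.
respond : Maybe ℕ → ℝ⁺ → ℝ⁺
respond nothing  x = x
respond (just c) _ = nat⁺ c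

respondℕ : Maybe ℕ → ℕ → ℕ
respondℕ nothing  n = n
respondℕ (just c) _ = c

respond-nat : ∀ m x n → val x ≐ val (nat⁺ n) → val (respond m x) ≐ val (nat⁺ (respondℕ m n))
respond-nat nothing  x n eq = eq
respond-nat (just c) x n eq _ = refl

respond-continuous : ∀ m → Continuous (respond m)
respond-continuous nothing  x ε ε>0 = ε , ε>0 , λ y h → h
respond-continuous (just c) x ε ε>0 = ε , ε>0 , λ y _ →
  ≤-<-trans ∣ val (nat⁺ c) - val (nat⁺ c) ∣ 0ℝ ε
    (≐⇒≤ ∣ val (nat⁺ c) - val (nat⁺ c) ∣ 0ℝ λ _ → cong ℚ.∣_∣ (ℚ.+-inverseʳ (natℚ c))) ε>0

respond-nonDecreasing : ∀ m → NonDecreasing (respond m)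
respond-nonDecreasing nothing  x y x≤y = x≤y
respond-nonDecreasing (just c) x y _   = ≤-refl (val (nat⁺ c))

latency : (G : Net) → (Net.Edge G → Maybe ℕ) → Latency G
latency G law = record
  { fun           = λ e → respond (law e)
  ; continuous    = λ e → respond-continuous (law e)
  ; nonDecreasing = λ e → respond-nonDecreasing (law e)
  }

-- A potential π that is feasible for all edges and tight on p and p′ certifies
-- that one unit of flow on each of them is a Wardrop flow.
module TwoUnits (G : Net) (law : Net.Edge G → Maybe ℕ) (p p′ : Net.SP G) where
  open Net G
  open Walks graph
  open DecMembership (Fin._≟_ {#edges}) using (_∈?_)

  -- The two paths may coincide; that path then carries both units, as in the flow on `G` below.
  units : SP → ℕ
  units q = indicator (q ≟ˢ p) ℕ.+ indicator (q ≟ˢ p′)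

  flow : Flow G
  flow q = nat⁺ (units q)

  unitLoad : Edge → ℕ
  unitLoad e = indicator (e ∈? edges (path p)) ℕ.+ indicator (e ∈? edges (path p′))

  unitCost : Edge → ℕ
  unitCost e = respondℕ (law e) (unitLoad e)

  private
    through-count : ∀ q e → sum (List.map (λ x → indicator (x ≟ˢ q)) (through e)) ≡
                            indicator (e ∈? edges (path q))
    through-count q e = count (e ∈? edges (path q))
      where
      on? : ∀ x → Dec (e ∈ edges (path x))
      on? x = e ∈? edges (path x)

      count : (d : Dec (e ∈ edges (path q))) →
              sum (List.map (λ x → indicator (x ≟ˢ q)) (through e)) ≡ indicator d
      count (yes e∈) = sum-indicator-∈ _≟ˢ_ (Unique.filter⁺ on? (simplePaths-unique s t))
        (∈-filter⁺ on? (∈-simplePaths q) e∈)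
      count (no e∉)  = sum-indicator-∉ _≟ˢ_ λ q∈ → e∉ (∈-filter⁻ on? {xs = allSP} q∈ .proj₂)

    edgeFlow-units : ∀ e → val (edgeFlow G flow e) ≐ val (nat⁺ (unitLoad e))
    edgeFlow-units e n = trans (sum⁺-nat (λ _ _ → refl) (through e) n)
      (cong natℚ (trans (sum-map-+ (λ x → indicator (x ≟ˢ p)) (λ x → indicator (x ≟ˢ p′)) (through e))
        (cong₂ ℕ._+_ (through-count p e) (through-count p′ e))))

    value-units : val (value G flow) ≐ val (nat⁺ 2)
    value-units n = trans (sum⁺-nat (λ _ _ → refl) allSP n)
      (cong natℚ (trans (sum-map-+ (λ x → indicator (x ≟ˢ p)) (λ x → indicator (x ≟ˢ p′)) allSP)
        (cong₂ ℕ._+_ (one p) (one p′))))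
      where
      one : ∀ q → sum (List.map (λ x → indicator (x ≟ˢ q)) allSP) ≡ 1
      one q = sum-indicator-∈ _≟ˢ_ (simplePaths-unique s t) (∈-simplePaths q)

    pathLatency-units : ∀ q → val (pathLatency G (latency G law) flow q) ≐
                              val (nat⁺ (sum (List.map unitCost (edges q))))
    pathLatency-units q = sum⁺-nat
      (λ e → respond-nat (law e) (edgeFlow G flow e) (unitLoad e) (edgeFlow-units e)) (edges q)

    used : ∀ q → 0ℝ < val (flow q) → q ≡ p ⊎ q ≡ p′
    used q pos = decide (q ≟ˢ p) (q ≟ˢ p′) pos
      where
      decide : (d : Dec (q ≡ p)) (d′ : Dec (q ≡ p′)) →
               0ℝ < val (nat⁺ (indicator d ℕ.+ indicator d′)) → q ≡ p ⊎ q ≡ p′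
      decide (yes eq) _        _   = inj₁ eq
      decide (no _)   (yes eq) _   = inj₂ eq
      decide (no _)   (no _)   pos = contradiction pos (≤⇒≯ 0ℝ 0ℝ (≤-refl 0ℝ))

  module _ (π : Node → ℕ) (π-source : π s ≡ 0)
           (feasible : ∀ e → π (tgt e) ℕ.≤ unitCost e ℕ.+ π (src e))
           (tight : ∀ {e} q → e ∈ edges (path q) → q ≡ p ⊎ q ≡ p′ →
              π (tgt e) ≡ unitCost e ℕ.+ π (src e))
           where

    private
      Σc : ∀ {u v} → Path u v → ℕ
      Σc q = sum (List.map unitCost (edges q))

      +-shift : ∀ k m n → k ℕ.+ (m ℕ.+ n) ≡ (m ℕ.+ k) ℕ.+ n
      +-shift k m n = trans (sym (ℕ.+-assoc k m n)) (cong (ℕ._+ n) (ℕ.+-comm k m))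

      -- The potential differences telescope along the walk.
      walk-cost≥ : ∀ {u v} (q : Path u v) → π v ℕ.≤ Σc q ℕ.+ π u
      walk-cost≥ []                = ℕ.≤-refl
      walk-cost≥ (e ∷⟨ refl ⟩ q) = ℕ.≤-trans (walk-cost≥ q)
        (ℕ.≤-trans (ℕ.+-monoʳ-≤ (Σc q) (feasible e))
          (ℕ.≤-reflexive (+-shift (Σc q) (unitCost e) (π (src e)))))

      walk-cost≡ : ∀ {u v} (q : Path u v) →
                   (∀ {e} → e ∈ edges q → π (tgt e) ≡ unitCost e ℕ.+ π (src e)) → π v ≡ Σc q ℕ.+ π u
      walk-cost≡ []                _ = refl
      walk-cost≡ (e ∷⟨ refl ⟩ q) h = trans (walk-cost≡ q (h ∘ there))
        (trans (cong (Σc q ℕ.+_) (h (here refl))) (+-shift (Σc q) (unitCost e) (π (src e))))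

      +π-source : ∀ n → n ℕ.+ π s ≡ n
      +π-source n = trans (cong (n ℕ.+_) π-source) (ℕ.+-identityʳ n)

      used-cost : ∀ q → 0ℝ < val (flow q) → Σc (path q) ≡ π t
      used-cost q pos = sym (trans (walk-cost≡ (path q) (λ e∈ → tight q e∈ (used q pos)))
        (+π-source (Σc (path q))))

      π≤cost : ∀ (q : STPath) → π t ℕ.≤ Σc q
      π≤cost q = subst (π t ℕ.≤_) (+π-source (Σc q)) (walk-cost≥ q)

      PL : STPath → ℝ
      PL q = val (pathLatency G (latency G law) flow q)

    isL : IsL G (nat⁺ 2) (latency G law) (nat⁺ (π t))
    isL = inj₂
      (<-≤-trans 0ℝ (val (nat⁺ 1)) (val (nat⁺ 2)) (nat⁺-suc 0)
        (<⇒≤ (val (nat⁺ 1)) (val (nat⁺ 2)) (nat⁺-suc 1)) ,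
      flow ,
      ( ≐⇒≃ (val (value G flow)) (val (nat⁺ 2)) value-units
      , λ q q′ pos → ≤-trans (PL (path q)) (val (nat⁺ (π t))) (PL q′)
          (≐⇒≤ (PL (path q)) (val (nat⁺ (π t))) (used-latency q pos))
          (≤-trans (val (nat⁺ (π t))) (val (nat⁺ (Σc q′))) (PL q′) (nat⁺-mono (π≤cost q′))
            (≐⇒≤ (val (nat⁺ (Σc q′))) (PL q′) λ n → sym (pathLatency-units q′ n)))) ,
      λ q pos → ≐⇒≃ (PL (path q)) (val (nat⁺ (π t))) (used-latency q pos))
      where
      used-latency : ∀ q → 0ℝ < val (flow q) → PL (path q) ≐ val (nat⁺ (π t))
      used-latency q pos n = trans (pathLatency-units (path q) n) (cong natℚ (used-cost q pos))

-- Subnets obtained by deleting edges.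

module KeepEdges (G : Net) {Kept : Net.Edge G → Set} (kept? : ∀ e → Dec (Kept e)) where
  private module G = Net G

  kept : List G.Edge
  kept = List.filter kept? (List.allFin G.#edges)

  -- All nodes stay. The kept edges are renumbered by their positions in `kept`, which has no
  -- repetitions.
  subnet : Subnet G
  subnet = record
    { net            = record
      { graph = record
        { #nodes = G.#nodes
        ; #edges = List.length kept
        ; src    = G.src ∘ List.lookup kept
        ; tgt    = G.tgt ∘ List.lookup kept
        }
      ; s     = G.s
      ; t     = G.t
      }
    ; node           = id
    ; edge           = List.lookup kept
    ; node-injective = id
    ; edge-injective = lookup-injective (Unique.filter⁺ kept? (Unique.allFin⁺ G.#edges))
    ; src-edge       = λ _ → refl
    ; tgt-edge       = λ _ → refl
    ; source         = refl
    ; target         = refl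
    }

  private module H = Net (Subnet.net subnet)
  open Subnet subnet using (edge)

  edge-kept : ∀ e → Kept (edge e)
  edge-kept e = ∈-filter⁻ kept? {xs = List.allFin G.#edges} (∈-lookup e) .proj₂

  private
    -- The edge equation is a separate argument so that matching on it identifies the ends of e with
    -- those of its copy.
    via : ∀ {u v e} i → e ≡ edge i → G.src e ≡ u → H.Path (G.tgt e) v → H.Path u v
    via i refl eq p = i H.∷⟨ eq ⟩ p

    edges-via : ∀ {u v e} i (e≡ : e ≡ edge i) (eq : G.src e ≡ u) (p : H.Path (G.tgt e) v) →
                List.map edge (H.edges (via i e≡ eq p)) ≡ e ∷ List.map edge (H.edges p)
    edges-via i refl eq p = refl

    nodes-via : ∀ {u v e} i (e≡ : e ≡ edge i) (eq : G.src e ≡ u) (p : H.Path (G.tgt e) v) →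
                H.nodes (via i e≡ eq p) ≡ u ∷ H.nodes p
    nodes-via i refl eq p = refl

    index : ∀ {e} → Kept e → ∃ λ i → e ≡ edge i
    index {e} k = let e∈ = ∈-filter⁺ kept? (∈-allFin e) k in Any.index e∈ , Any.lookup-index e∈

  restrictPath : ∀ {u v} (p : G.Path u v) → All Kept (G.edges p) → H.Path u v
  restrictPath G.[]              []       = H.[]
  restrictPath (e G.∷⟨ eq ⟩ p) (k ∷ ks) = via (index k .proj₁) (index k .proj₂) eq (restrictPath p ks)

  edges-restrictPath : ∀ {u v} (p : G.Path u v) (ks : All Kept (G.edges p)) →
                       List.map edge (H.edges (restrictPath p ks)) ≡ G.edges p
  edges-restrictPath G.[]              []       = refl
  edges-restrictPath (e G.∷⟨ eq ⟩ p) (k ∷ ks) =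
    trans (edges-via (index k .proj₁) (index k .proj₂) eq (restrictPath p ks))
      (cong (e ∷_) (edges-restrictPath p ks))

  nodes-restrictPath : ∀ {u v} (p : G.Path u v) (ks : All Kept (G.edges p)) →
                       H.nodes (restrictPath p ks) ≡ G.nodes p
  nodes-restrictPath G.[]              []       = refl
  nodes-restrictPath {u} (e G.∷⟨ eq ⟩ p) (k ∷ ks) =
    trans (nodes-via (index k .proj₁) (index k .proj₂) eq (restrictPath p ks))
      (cong (u ∷_) (nodes-restrictPath p ks))

  restrictSP : (p : G.SP) → All Kept (G.edges (G.path p)) → H.SP
  restrictSP p ks = H.mkSimple (restrictPath (G.path p) ks)
    (subst Unique (sym (nodes-restrictPath (G.path p) ks)) (G.simple! p))

  ∈-restrictSP⁺ : ∀ p ks {e} → edge e ∈ G.edges (G.path p) → e ∈ H.edges (H.path (restrictSP p ks))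
  ∈-restrictSP⁺ p ks {e} e∈
    with f , f∈ , eq ← ∈-map⁻ edge (subst (edge e ∈_) (sym (edges-restrictPath (G.path p) ks)) e∈)
    with refl ← Subnet.edge-injective subnet eq = f∈

  ∈-restrictSP⁻ : ∀ p ks {e} → e ∈ H.edges (H.path (restrictSP p ks)) → edge e ∈ G.edges (G.path p)
  ∈-restrictSP⁻ p ks {e} e∈ = subst (edge e ∈_) (edges-restrictPath (G.path p) ks) (∈-map⁺ edge e∈)

-- Regions and routes of an embedded Wheatstone graph.

module Embedded (G : Net) (E : STEmbedding G) where
  open STEmbedding E
  open Net G
  open Walks graph
  open DecMembership (Fin._≟_ {#nodes}) using (_∈?_)
  private module W = Wheatstone

  end∈ψ : ∀ {x} e → x EndpointOf e → ϕ x ∈ nodes (path (ψ e))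
  end∈ψ e (inj₁ refl) = first∈ (path (ψ e))
  end∈ψ e (inj₂ refl) = last∈ (path (ψ e))

  incident : ∀ x → ∃ λ e → x EndpointOf e
  incident A = AB , inj₁ refl
  incident B = AB , inj₂ refl
  incident C = AC , inj₂ refl
  incident D = BD , inj₂ refl

  -- x is an end of some side f. If f is not e, both sides contain `ϕ x`, and disjointness makes x
  -- one of their common corners.
  corner-on-side : ∀ {x} e → ϕ x ∈ nodes (path (ψ e)) → x EndpointOf e
  corner-on-side {x} e x∈ = compare (incident x)
    where
    compare : (∃ λ f → x EndpointOf f) → x EndpointOf e
    compare (f , x-f) with f Fin.≟ e
    ... | yes refl = x-f
    ... | no f≢e with y , eq , _ , y-e ← ψ-disjoint f e f≢e (ϕ x) (end∈ψ f x-f) x∈ =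
      subst (_EndpointOf e) (sym (ϕ-injective eq)) y-e

  Cell : W.Edge → Node → Set
  Cell e v = v ∈ nodes (path (ψ e)) × v ≢ ϕ (W.src e)

  cell? : ∀ v e → Dec (Cell e v)
  cell? v e = (v ∈? nodes (path (ψ e))) ×-dec ¬? (v Fin.≟ ϕ (W.src e))

  corner-cell : ∀ {x} e → Cell e (ϕ x) → x ≡ W.tgt e
  corner-cell e (x∈ , x≢) = [ (λ eq → contradiction (cong ϕ eq) x≢) , id ]′ (corner-on-side e x∈)

  -- Distinct sides meet only in corners, and the only corner in a cell is the one where its side
  -- ends.
  cell-unique : ∀ {v} e f → Cell e v → Cell f v → W.tgt e ≡ W.tgt f
  cell-unique {v} e f e-v f-v with e Fin.≟ f
  ... | yes refl = refl
  ... | no e≢f with x , refl , _ ← ψ-disjoint e f e≢f v (e-v .proj₁) (f-v .proj₁) =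
    trans (sym (corner-cell e e-v)) (corner-cell f f-v)

  private
    regionOf : ∀ {v} → Dec (v ∈ nodes (path tail)) → Dec (∃ λ e → Cell e v) → W.Node
    regionOf (yes _) _            = D
    regionOf (no _) (yes (e , _)) = W.tgt e
    regionOf (no _) (no _)        = A

  -- The sides of the embedding without their first nodes are disjoint unless
  -- they end in the same corner, so they divide the nodes by that corner;
  -- the tail joins D, and everything else, in particular the head, joins A.
  region : Node → W.Node
  region v = regionOf {v} (v ∈? nodes (path tail)) (Fin.any? (cell? v))

  region-tail : ∀ {v} → v ∈ nodes (path tail) → region v ≡ D
  region-tail {v} v∈ = decide (v ∈? nodes (path tail)) (Fin.any? (cell? v))
    where
    decide : (d : Dec (v ∈ nodes (path tail))) (d′ : Dec (∃ λ e → Cell e v)) →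
             regionOf {v} d d′ ≡ D
    decide (yes _) _ = refl
    decide (no v∉) _ = contradiction v∈ v∉

  region-cell : ∀ {v} e → Cell e v → region v ≡ W.tgt e
  region-cell {v} e e-v = decide (v ∈? nodes (path tail)) (Fin.any? (cell? v))
    where
    decide : (d : Dec (v ∈ nodes (path tail))) (d′ : Dec (∃ λ e → Cell e v)) →
             regionOf {v} d d′ ≡ W.tgt e
    decide (yes v∈) _ with refl ← tail-disjoint e v v∈ (e-v .proj₁) = corner-cell e e-v
    decide (no _) (yes (f , f-v)) = cell-unique f e f-v e-v
    decide (no _) (no none)       = contradiction (e , e-v) none

  region-head : ∀ {v} → v ∈ nodes (path head) → region v ≡ A
  region-head {v} v∈ = decide (v ∈? nodes (path tail)) (Fin.any? (cell? v))
    where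
    A-minimal : ∀ e → A ≢ W.tgt e
    A-minimal = from-yes (Fin.all? λ e → ¬? (A Fin.≟ W.tgt e))

    decide : (d : Dec (v ∈ nodes (path tail))) (d′ : Dec (∃ λ e → Cell e v)) →
             regionOf {v} d d′ ≡ A
    decide (yes v∈′) _ = contradiction v∈′ (head-tail v v∈)
    decide (no _) (yes (e , e-v)) with refl ← head-disjoint e v v∈ (e-v .proj₁) =
      contradiction (corner-cell e e-v) (A-minimal e)
    decide (no _) (no _) = refl

  region-corner : ∀ x → region (ϕ x) ≡ x
  region-corner A = region-head (last∈ (path head))
  region-corner B = region-cell AB (last∈ (path (ψ AB)) , λ eq → contradiction (ϕ-injective eq) λ ())
  region-corner C = region-cell AC (last∈ (path (ψ AC)) , λ eq → contradiction (ϕ-injective eq) λ ())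
  region-corner D = region-tail (first∈ (path tail))

  region-tgt : ∀ {e} f → e ∈ edges (path (ψ f)) → region (tgt e) ≡ W.tgt f
  region-tgt f e∈ = region-cell f (tgt∈ (path (ψ f)) e∈ , tgt≢first (path (ψ f)) (simple! (ψ f)) e∈)

  -- Only an edge that starts at the first corner of the side can change region; every other source
  -- already lies in the cell.
  region-src : ∀ {e} f → e ∈ edges (path (ψ f)) → region (src e) ≡ W.src f ⊎ region (src e) ≡ W.tgt f
  region-src {e} f e∈ with src e Fin.≟ ϕ (W.src f)
  ... | yes eq = inj₁ (trans (cong region eq) (region-corner (W.src f)))
  ... | no neq = inj₂ (region-cell f (src∈ (path (ψ f)) e∈ , neq))

  route : ∀ {x y} → W.Path x y → Path (ϕ x) (ϕ y)
  route W.[]              = []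
  route (e W.∷⟨ refl ⟩ q) = path (ψ e) ⊕ route q

  ∈-route-nodes⁻ : ∀ {x y v} (q : W.Path x y) → v ∈ nodes (route q) →
                   v ≡ ϕ x ⊎ ∃ λ f → f ∈ W.edges q × v ∈ nodes (path (ψ f))
  ∈-route-nodes⁻ W.[]              (here refl) = inj₁ refl
  ∈-route-nodes⁻ (e W.∷⟨ refl ⟩ q) v∈ with ∈-⊕⁻ (path (ψ e)) (route q) v∈
  ... | inj₁ v∈e = inj₂ (e , here refl , v∈e)
  ... | inj₂ v∈q with ∈-route-nodes⁻ q v∈q
  ...   | inj₁ refl             = inj₂ (e , here refl , last∈ (path (ψ e)))
  ...   | inj₂ (f , f∈ , v∈f) = inj₂ (f , there f∈ , v∈f)

  ∈-route-edges⁻ : ∀ {x y e} (q : W.Path x y) → e ∈ edges (route q) →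
                   ∃ λ f → f ∈ W.edges q × e ∈ edges (path (ψ f))
  ∈-route-edges⁻ {e = e} (f W.∷⟨ refl ⟩ q) e∈
    with ∈-++⁻ (edges (path (ψ f))) (subst (e ∈_) (edges-⊕ (path (ψ f)) (route q)) e∈)
  ... | inj₁ e∈f = f , here refl , e∈f
  ... | inj₂ e∈q with g , g∈ , e∈g ← ∈-route-edges⁻ q e∈q = g , there g∈ , e∈g

  ∈-⊕ˡ : ∀ {u v w e} (p : Path u v) (q : Path v w) → e ∈ edges p → e ∈ edges (p ⊕ q)
  ∈-⊕ˡ {e = e} p q e∈ = subst (e ∈_) (sym (edges-⊕ p q)) (∈-++⁺ˡ e∈)

  ∈-⊕ʳ : ∀ {u v w e} (p : Path u v) (q : Path v w) → e ∈ edges q → e ∈ edges (p ⊕ q)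
  ∈-⊕ʳ {e = e} p q e∈ = subst (e ∈_) (sym (edges-⊕ p q)) (∈-++⁺ʳ (edges p) e∈)

  ∈-route-edges⁺ : ∀ {x y e f} (q : W.Path x y) → f ∈ W.edges q → e ∈ edges (path (ψ f)) →
                   e ∈ edges (route q)
  ∈-route-edges⁺ (f W.∷⟨ refl ⟩ q) (here refl) e∈ = ∈-⊕ˡ (path (ψ f)) (route q) e∈
  ∈-route-edges⁺ (g W.∷⟨ refl ⟩ q) (there f∈)  e∈ =
    ∈-⊕ʳ (path (ψ g)) (route q) (∈-route-edges⁺ q f∈ e∈)

  -- The source of e does not recur on q. Hence later sides differ from e, and the only corner they
  -- can share with it is its target.
  simple-route : ∀ {x y} (q : W.Path x y) → W.Simple q → Simple (route q)
  simple-route W.[]              _         = [] ∷ []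
  simple-route (e W.∷⟨ refl ⟩ q) (x∉ ∷ sq) =
    simple-⊕ (path (ψ e)) (route q) (simple! (ψ e)) (simple-route q sq) meet
    where
    meet-side : ∀ {v} f → f ∈ W.edges q → v ∈ nodes (path (ψ e)) → v ∈ nodes (path (ψ f)) →
                v ≡ ϕ (W.tgt e)
    meet-side {v} f f∈ v∈e v∈f = shared (ψ-disjoint e f e≢f v v∈e v∈f)
      where
      e≢f : e ≢ f
      e≢f refl = All.lookup x∉ (W.src∈ q f∈) refl

      end∈q : ∀ {y} → y EndpointOf f → y ∈ W.nodes q
      end∈q (inj₁ refl) = W.src∈ q f∈
      end∈q (inj₂ refl) = W.tgt∈ q f∈

      shared : (∃ λ y → v ≡ ϕ y × y EndpointOf e × y EndpointOf f) → v ≡ ϕ (W.tgt e)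
      shared (y , v≡ , inj₁ refl , y-f) = contradiction refl (All.lookup x∉ (end∈q y-f))
      shared (y , v≡ , inj₂ refl , _)   = v≡

    meet : ∀ {v} → v ∈ nodes (path (ψ e)) → v ∈ nodes (route q) → v ≡ ϕ (W.tgt e)
    meet v∈e v∈q = [ id , (λ (f , f∈ , v∈f) → meet-side f f∈ v∈e v∈f) ]′ (∈-route-nodes⁻ q v∈q)

  module _ (q : W.Path A D) (sq : W.Simple q) where

    through-route : SP
    through-route = mkSimple (path head ⊕ (route q ⊕ path tail))
      (simple-⊕ (path head) (route q ⊕ path tail) (simple! head)
        (simple-⊕ (route q) (path tail) (simple-route q sq) (simple! tail) route-tail)
        (λ v∈ v∈′ → head-route v∈ (∈-⊕⁻ (route q) (path tail) v∈′)))
      where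
      route-tail : ∀ {v} → v ∈ nodes (route q) → v ∈ nodes (path tail) → v ≡ ϕ D
      route-tail {v} v∈ v∈t with ∈-route-nodes⁻ q v∈
      ... | inj₁ refl           = contradiction v∈t (head-tail v (last∈ (path head)))
      ... | inj₂ (f , _ , v∈f) = tail-disjoint f v v∈t v∈f

      head-route : ∀ {v} → v ∈ nodes (path head) →
                   v ∈ nodes (route q) ⊎ v ∈ nodes (path tail) → v ≡ ϕ A
      head-route {v} v∈h (inj₂ v∈t) = contradiction v∈t (head-tail v v∈h)
      head-route {v} v∈h (inj₁ v∈q) with ∈-route-nodes⁻ q v∈q
      ... | inj₁ v≡             = v≡
      ... | inj₂ (f , _ , v∈f) = head-disjoint f v v∈h v∈f

    ∈-through⁺ : ∀ {e f} → f ∈ W.edges q → e ∈ edges (path (ψ f)) → e ∈ edges (path through-route)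
    ∈-through⁺ f∈ e∈ = ∈-⊕ʳ (path head) (route q ⊕ path tail)
      (∈-⊕ˡ (route q) (path tail) (∈-route-edges⁺ q f∈ e∈))

    -- Head and tail stay in regions A and D, and each side changes region with its first edge only.
    -- Elsewhere on the route the potentials are constant.
    through-regions : ∀ {e} → e ∈ edges (path through-route) →
      region (src e) ≡ region (tgt e) ⊎
      ∃ λ f → f ∈ W.edges q × e ∈ edges (path (ψ f)) × region (src e) ≡ W.src f
    through-regions {e} e∈
      with ∈-++⁻ (edges (path head)) (subst (e ∈_) (edges-⊕ (path head) (route q ⊕ path tail)) e∈)
    ... | inj₁ e∈h = inj₁ (trans (region-head (src∈ (path head) e∈h))
                                 (sym (region-head (tgt∈ (path head) e∈h))))
    ... | inj₂ e∈′ with ∈-++⁻ (edges (route q)) (subst (e ∈_) (edges-⊕ (route q) (path tail)) e∈′)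
    ...   | inj₂ e∈t = inj₁ (trans (region-tail (src∈ (path tail) e∈t))
                                   (sym (region-tail (tgt∈ (path tail) e∈t))))
    ...   | inj₁ e∈q with f , f∈ , e∈f ← ∈-route-edges⁻ q e∈q with region-src f e∈f
    ...     | inj₁ eq = inj₂ (f , f∈ , e∈f , eq)
    ...     | inj₂ eq = inj₁ (trans eq (sym (region-tgt f e∈f)))

    -- `𝒲` has no loops, so the edge changes region and starts some side g of the route; as g has
    -- the ends of f, it is f.
    through-side : ∀ {e} f → e ∈ edges (path through-route) →
                   region (src e) ≡ W.src f → region (tgt e) ≡ W.tgt f → f ∈ W.edges q
    through-side f e∈ s≡ t≡ with through-regions e∈
    ... | inj₁ eq = contradiction (trans (sym s≡) (trans eq t≡)) (loop-free f)
      where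
      loop-free : ∀ f → W.src f ≢ W.tgt f
      loop-free = from-yes (Fin.all? λ f → ¬? (W.src f Fin.≟ W.tgt f))
    ... | inj₂ (g , g∈ , e∈g , s≡′) = subst (_∈ W.edges q)
      (parallel-free g f (trans (sym s≡′) s≡) (trans (sym (region-tgt g e∈g)) t≡)) g∈

-- Braess' latencies on the embedded graph.

module Paradox (G : Net) (E : STEmbedding G) where
  open Embedded G E
  open STEmbedding E
  open Net G
  private module W = Wheatstone
  open DecMembership (Fin._≟_ {#edges}) using (_∈?_)

  ABBCCD ABBD ACCD : W.Path A D
  ABBCCD = AB W.∷⟨ refl ⟩ (BC W.∷⟨ refl ⟩ (CD W.∷⟨ refl ⟩ W.[]))
  ABBD   = AB W.∷⟨ refl ⟩ (BD W.∷⟨ refl ⟩ W.[])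
  ACCD   = AC W.∷⟨ refl ⟩ (CD W.∷⟨ refl ⟩ W.[])

  ABBCCD-simple : W.Simple ABBCCD
  ABBCCD-simple = from-yes (W.simple? ABBCCD)

  ABBD-simple : W.Simple ABBD
  ABBD-simple = from-yes (W.simple? ABBD)

  ACCD-simple : W.Simple ACCD
  ACCD-simple = from-yes (W.simple? ACCD)

  -- The latencies at which the corners are reached before and after the
  -- deletion of BC.
  heightG heightH : W.Node → ℕ
  heightG = Vec.lookup (0 Vec.∷ 2 Vec.∷ 2 Vec.∷ 4 Vec.∷ Vec.[])
  heightH = Vec.lookup (0 Vec.∷ 1 Vec.∷ 2 Vec.∷ 3 Vec.∷ Vec.[])

  -- The region condition selects the first edge of the side, so each of AB and CD has a single edge
  -- whose latency depends on its load.
  Varying : Edge → Set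
  Varying e = (e ∈ edges (path (ψ AB)) × region (src e) ≡ A) ⊎
              (e ∈ edges (path (ψ CD)) × region (src e) ≡ C)

  varying? : ∀ e → Dec (Varying e)
  varying? e = ((e ∈? edges (path (ψ AB))) ×-dec (region (src e) Fin.≟ A)) ⊎-dec
               ((e ∈? edges (path (ψ CD))) ×-dec (region (src e) Fin.≟ C))

  -- Edges off the embedding get this latency too: a shortcut pays for the height it gains, which
  -- makes `heightG` feasible on all of `G`. Truncated subtraction makes descents free.
  climb : Edge → ℕ
  climb e = heightG (region (tgt e)) ℕ.∸ heightG (region (src e))

  law : Edge → Maybe ℕ
  law e with varying? e
  ... | yes _ = nothing
  ... | no _  = just (climb e)

  law-varying : ∀ e n → Varying e → respondℕ (law e) n ≡ n
  law-varying e n v with varying? e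
  ... | yes _ = refl
  ... | no ¬v = contradiction v ¬v

  law-fixed : ∀ e n → ¬ Varying e → respondℕ (law e) n ≡ climb e
  law-fixed e n ¬v with varying? e
  ... | yes v = contradiction v ¬v
  ... | no _  = refl

  -- Here k stands for the load of a varying edge, which is 2 before the deletion and 1 after it.
  varying-climb : ∀ (h : W.Node → ℕ) k → h B ≡ k ℕ.+ h A → h D ≡ k ℕ.+ h C → ∀ e → Varying e →
                  h (region (tgt e)) ≡ k ℕ.+ h (region (src e))
  varying-climb h k hB hD e (inj₁ (e∈ , s≡A)) =
    trans (cong h (region-tgt AB e∈)) (trans hB (cong (λ x → k ℕ.+ h x) (sym s≡A)))
  varying-climb h k hB hD e (inj₂ (e∈ , s≡C)) =
    trans (cong h (region-tgt CD e∈)) (trans hD (cong (λ x → k ℕ.+ h x) (sym s≡C)))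

  region-s : region s ≡ A
  region-s = region-head (Walks.first∈ graph (path head))

  region-t : region t ≡ D
  region-t = region-tail (Walks.last∈ graph (path tail))

  module InG where
    p = through-route ABBCCD ABBCCD-simple

    -- Both units take the same path ABCD, so each varying edge has load and latency 2.
    open TwoUnits G law p p

    π : Node → ℕ
    π = heightG ∘ region

    varying-∈ : ∀ {e} → Varying e → e ∈ edges (path p)
    varying-∈ (inj₁ (e∈ , _)) = ∈-through⁺ ABBCCD ABBCCD-simple (here refl) e∈
    varying-∈ (inj₂ (e∈ , _)) = ∈-through⁺ ABBCCD ABBCCD-simple (there (there (here refl))) e∈

    varying-cost : ∀ e → Varying e → π (tgt e) ≡ unitCost e ℕ.+ π (src e)
    varying-cost e v = trans (varying-climb heightG 2 refl refl e v)
      (cong (ℕ._+ π (src e)) (sym (trans (law-varying e (unitLoad e) v)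
        (cong₂ ℕ._+_ (indicator-yes (e ∈? edges (path p)) (varying-∈ v))
                     (indicator-yes (e ∈? edges (path p)) (varying-∈ v))))))

    fixed-cost : ∀ e → ¬ Varying e → unitCost e ℕ.+ π (src e) ≡ climb e ℕ.+ π (src e)
    fixed-cost e ¬v = cong (ℕ._+ π (src e)) (law-fixed e (unitLoad e) ¬v)

    feasible : ∀ e → π (tgt e) ℕ.≤ unitCost e ℕ.+ π (src e)
    feasible e = decide (varying? e)
      where
      decide : Dec (Varying e) → π (tgt e) ℕ.≤ unitCost e ℕ.+ π (src e)
      decide (yes v) = ℕ.≤-reflexive (varying-cost e v)
      decide (no ¬v) = subst (π (tgt e) ℕ.≤_)
        (trans (ℕ.+-comm (π (src e)) (climb e)) (sym (fixed-cost e ¬v)))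
        (ℕ.m≤n+m∸n (π (tgt e)) (π (src e)))

    -- On the used path truncation never takes effect, so the constant latencies are tight.
    ascending : ∀ {e} → e ∈ edges (path p) → π (src e) ℕ.≤ π (tgt e)
    ascending {e} e∈ = decide (through-regions ABBCCD ABBCCD-simple e∈)
      where
      monotone : ∀ f → heightG (W.src f) ℕ.≤ heightG (W.tgt f)
      monotone = from-yes (Fin.all? λ f → heightG (W.src f) ℕ.≤? heightG (W.tgt f))

      decide : (region (src e) ≡ region (tgt e) ⊎
        ∃ λ f → f ∈ W.edges ABBCCD × e ∈ edges (path (ψ f)) × region (src e) ≡ W.src f) →
        π (src e) ℕ.≤ π (tgt e)
      decide (inj₁ eq) = ℕ.≤-reflexive (cong heightG eq)
      decide (inj₂ (f , _ , e∈f , eq)) =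
        subst₂ (λ x y → heightG x ℕ.≤ heightG y) (sym eq) (sym (region-tgt f e∈f)) (monotone f)

    tight : ∀ {e} q → e ∈ edges (path q) → q ≡ p ⊎ q ≡ p → π (tgt e) ≡ unitCost e ℕ.+ π (src e)
    tight {e} q e∈ q≡ = decide (varying? e)
      where
      e∈p : e ∈ edges (path p)
      e∈p = subst (λ q → e ∈ edges (path q)) ([ id , id ]′ q≡) e∈

      decide : Dec (Varying e) → π (tgt e) ≡ unitCost e ℕ.+ π (src e)
      decide (yes v) = varying-cost e v
      decide (no ¬v) = sym (trans (fixed-cost e ¬v) (ℕ.m∸n+n≡m (ascending e∈p)))

    isL-G : IsL G (nat⁺ 2) (latency G law) (nat⁺ (π t))
    isL-G = isL π (cong heightG region-s) feasible tight

  -- All edges from region B to region C go, not just those of the side BC: they have latency 0,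
  -- while `heightH` rises from 1 to 2 between these regions.
  Kept : Edge → Set
  Kept e = ¬ (region (src e) ≡ B × region (tgt e) ≡ C)

  kept? : ∀ e → Dec (Kept e)
  kept? e = ¬? ((region (src e) Fin.≟ B) ×-dec (region (tgt e) Fin.≟ C))

  open KeepEdges G kept?
  private
    module H = Net (Subnet.net subnet)
  open Subnet subnet using (edge)
  open DecMembership (Fin._≟_ {H.#edges}) using () renaming (_∈?_ to _∈ᴴ?_)

  through-kept : ∀ q (sq : W.Simple q) → BC ∉ W.edges q → All Kept (edges (path (through-route q sq)))
  through-kept q sq BC∉ = All.tabulate λ e∈ (s≡B , t≡C) → BC∉ (through-side q sq BC e∈ s≡B t≡C)

  kept₁ : All Kept (edges (path (through-route ABBD ABBD-simple)))
  kept₁ = through-kept ABBD ABBD-simple λ { (here ()) ; (there (here ())) }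

  kept₂ : All Kept (edges (path (through-route ACCD ACCD-simple)))
  kept₂ = through-kept ACCD ACCD-simple λ { (here ()) ; (there (here ())) }

  module InH where
    p₁ p₂ : H.SP
    p₁ = restrictSP (through-route ABBD ABBD-simple) kept₁
    p₂ = restrictSP (through-route ACCD ACCD-simple) kept₂

    open TwoUnits (Subnet.net subnet) (law ∘ edge) p₁ p₂

    π : Node → ℕ
    π = heightH ∘ region

    -- Each varying edge lies on one of the two routes, and `through-side` excludes it from the
    -- other.
    varying-load : ∀ e → Varying (edge e) → unitLoad e ≡ 1
    varying-load e (inj₁ (e∈ , s≡A)) = cong₂ ℕ._+_
      (indicator-yes (e ∈ᴴ? H.edges (H.path p₁)) (∈-restrictSP⁺ (through-route ABBD ABBD-simple) kept₁
        (∈-through⁺ ABBD ABBD-simple (here refl) e∈)))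
      (indicator-no (e ∈ᴴ? H.edges (H.path p₂)) λ e∈p₂ → AB∉ (through-side ACCD ACCD-simple AB
        (∈-restrictSP⁻ (through-route ACCD ACCD-simple) kept₂ e∈p₂) s≡A (region-tgt AB e∈)))
      where
      AB∉ : AB ∉ W.edges ACCD
      AB∉ (here ())
      AB∉ (there (here ()))
    varying-load e (inj₂ (e∈ , s≡C)) = cong₂ ℕ._+_
      (indicator-no (e ∈ᴴ? H.edges (H.path p₁)) λ e∈p₁ → CD∉ (through-side ABBD ABBD-simple CD
        (∈-restrictSP⁻ (through-route ABBD ABBD-simple) kept₁ e∈p₁) s≡C (region-tgt CD e∈)))
      (indicator-yes (e ∈ᴴ? H.edges (H.path p₂)) (∈-restrictSP⁺ (through-route ACCD ACCD-simple) kept₂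
        (∈-through⁺ ACCD ACCD-simple (there (here refl)) e∈)))
      where
      CD∉ : CD ∉ W.edges ABBD
      CD∉ (here ())
      CD∉ (there (here ()))

    varying-cost : ∀ e → Varying (edge e) → π (H.tgt e) ≡ unitCost e ℕ.+ π (H.src e)
    varying-cost e v = trans (varying-climb heightH 1 refl refl (edge e) v)
      (cong (ℕ._+ π (H.src e)) (sym (trans (law-varying (edge e) (unitLoad e) v) (varying-load e v))))

    fixed-cost : ∀ e → ¬ Varying (edge e) → unitCost e ℕ.+ π (H.src e) ≡ climb (edge e) ℕ.+ π (H.src e)
    fixed-cost e ¬v = cong (ℕ._+ π (H.src e)) (law-fixed (edge e) (unitLoad e) ¬v)

    feasible : ∀ e → π (H.tgt e) ℕ.≤ unitCost e ℕ.+ π (H.src e)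
    feasible e = decide (varying? (edge e))
      where
      -- The latencies are still differences of `heightG`. Among all pairs of regions, only from B
      -- to C are they too small for `heightH`.
      steep : ∀ x y → ¬ (x ≡ B × y ≡ C) → heightH y ℕ.≤ (heightG y ℕ.∸ heightG x) ℕ.+ heightH x
      steep = from-yes (Fin.all? λ x → Fin.all? λ y → ¬? ((x Fin.≟ B) ×-dec (y Fin.≟ C)) →-dec
        (heightH y ℕ.≤? (heightG y ℕ.∸ heightG x) ℕ.+ heightH x))

      decide : Dec (Varying (edge e)) → π (H.tgt e) ℕ.≤ unitCost e ℕ.+ π (H.src e)
      decide (yes v) = ℕ.≤-reflexive (varying-cost e v)
      decide (no ¬v) = subst (π (H.tgt e) ℕ.≤_) (sym (fixed-cost e ¬v))
        (steep (region (H.src e)) (region (H.tgt e)) (edge-kept e))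

    -- The sides AC and BD gain 2 under both height functions, while on AB and CD only the varying
    -- first edges change region.
    fixed-climb : ∀ {e} q (sq : W.Simple q) → BC ∉ W.edges q → e ∈ edges (path (through-route q sq)) →
                  ¬ Varying e → π (tgt e) ≡ climb e ℕ.+ π (src e)
    fixed-climb {e} q sq BC∉ e∈ ¬v = decide (through-regions q sq e∈)
      where
      Level : W.Node → W.Node → Set
      Level x y = heightH y ≡ (heightG y ℕ.∸ heightG x) ℕ.+ heightH x

      level-refl : ∀ x → Level x x
      level-refl = from-yes (Fin.all? λ x → heightH x ℕ.≟ (heightG x ℕ.∸ heightG x) ℕ.+ heightH x)

      level-side : ∀ f → f ∈ W.edges q → e ∈ edges (path (ψ f)) → region (src e) ≡ W.src f →
                   Level (W.src f) (W.tgt f)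
      level-side AB f∈ e∈f eq = contradiction (inj₁ (e∈f , eq)) ¬v
      level-side AC f∈ e∈f eq = refl
      level-side BC f∈ e∈f eq = contradiction f∈ BC∉
      level-side BD f∈ e∈f eq = refl
      level-side CD f∈ e∈f eq = contradiction (inj₂ (e∈f , eq)) ¬v

      decide : (region (src e) ≡ region (tgt e) ⊎
        ∃ λ f → f ∈ W.edges q × e ∈ edges (path (ψ f)) × region (src e) ≡ W.src f) →
        Level (region (src e)) (region (tgt e))
      decide (inj₁ eq) = subst (Level (region (src e))) eq (level-refl (region (src e)))
      decide (inj₂ (f , f∈ , e∈f , eq)) =
        subst₂ Level (sym eq) (sym (region-tgt f e∈f)) (level-side f f∈ e∈f eq)

    tight : ∀ {e} q → e ∈ H.edges (H.path q) → q ≡ p₁ ⊎ q ≡ p₂ →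
            π (H.tgt e) ≡ unitCost e ℕ.+ π (H.src e)
    tight {e} q e∈ q≡ = decide (varying? (edge e)) q≡
      where
      decide : Dec (Varying (edge e)) → q ≡ p₁ ⊎ q ≡ p₂ → π (H.tgt e) ≡ unitCost e ℕ.+ π (H.src e)
      decide (yes v) _          = varying-cost e v
      decide (no ¬v) (inj₁ eq) = trans
        (fixed-climb ABBD ABBD-simple (λ { (here ()) ; (there (here ())) })
          (∈-restrictSP⁻ (through-route ABBD ABBD-simple) kept₁
            (subst (λ q → e ∈ H.edges (H.path q)) eq e∈)) ¬v)
        (sym (fixed-cost e ¬v))
      decide (no ¬v) (inj₂ eq) = trans
        (fixed-climb ACCD ACCD-simple (λ { (here ()) ; (there (here ())) })
          (∈-restrictSP⁻ (through-route ACCD ACCD-simple) kept₂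
            (subst (λ q → e ∈ H.edges (H.path q)) eq e∈)) ¬v)
        (sym (fixed-cost e ¬v))

    isL-H : IsL (Subnet.net subnet) (nat⁺ 2) (latency (Subnet.net subnet) (law ∘ edge)) (nat⁺ (π t))
    isL-H = isL π (cong heightH region-s) feasible tight

  vulnerable : Vulnerable G
  vulnerable = nat⁺ 2 , latency G law , subnet , H.path InH.p₁ ,
    nat⁺ (InG.π t) , nat⁺ (InH.π t) , InG.isL-G , InH.isL-H ,
    -- The target lies in region D, whose height is 4 before the deletion and 3 after it.
    subst (λ x → nat⁺ (heightH x) <⁺ nat⁺ (heightG x)) (sym region-t) (nat⁺-suc 3)

theorem4p10 : (G : Net) → STConnected G → Vulnerable G ⇔ STEmbedding G
theorem4p10 G _ = mk⇔ (vulnerable⇒embedding G) (Paradox.vulnerable G)
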